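{- Let $n \ge 1$ and let $f:\{0,1\}^n\to\{0,1\}$ be such that $\|\hat f\|_1 = A$ and $|\{\alpha \mid \hat f(\alpha)\neq 0\}| = s$. Then $f$ can be computed by a parity decision tree of depth (at most) $A^2\log s$.
   Context: Identify $\{0,1\}^n$ with $\mathbb{Z}_2^n$. For $\alpha\in\mathbb{Z}_2^n$ let $\chi_\alpha(x)=(-1)^{\sum_i\alpha_i x_i}$, $\hat f(\alpha)=\mathbb{E}_x[f(x)\chi_\alpha(x)]$ ($x$ uniform in $\mathbb{Z}_2^n$), and $\|\hat f\|_1=\sum_{\alpha}|\hat f(\alpha)|$. Logarithms are to base 2. A parity decision tree ($\oplus$-DT) is a binary tree in which every internal node is labeled by a linear function $\alpha\in\mathbb{Z}_2^n$ and every leaf by an output value in the range of Boolean functions considered (here $\{0,1\}$). On input $x$, the computation starts at the root; at an internal node labeled $\alpha$ it evaluates $\langle\alpha,x\rangle \bmod 2$ and moves to the left child if the value is $0$ and to the right child if it is $1$; at a leaf it outputs the leaf's label. The tree computes $f$ if on every input $x$ it outputs $f(x)$. Its depth is the maximal number of edges on a path from the root to a leaf. -}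

module Defs where

open import Data.Bool.Base using (Bool; true; false; _∧_; _xor_; if_then_else_)
open import Data.Integer.Base using (+_; -[1+_])
open import Data.List.Base using (List; []; _∷_; _++_; map; foldr; filter; length)
open import Data.Nat.Base as ℕ using (ℕ; zero; suc)
open import Data.Nat.Properties using (m^n≢0)
open import Data.Rational.Base as ℚ using (ℚ; mkℚ; 0ℚ; 1ℚ; _/_)
open import Data.Rational.Properties using (_≟_)
open import Data.Vec.Base as Vec using (Vec)
open import Relation.Binary.PropositionalEquality.Core using (_≡_)
open import Relation.Nullary.Decidable.Core using (¬?)

-- ℤ₂ is Bool with addition _xor_ and multiplication _∧_; the set {0,1} is
-- identified with it (0 = false, 1 = true).
Cube : ℕ → Set
Cube n = Vec Bool n

-- Every point of the cube is listed exactly once.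
cube : ∀ n → List (Cube n)
cube zero    = Vec.[] ∷ []
cube (suc n) = map (false Vec.∷_) (cube n) ++ map (true Vec.∷_) (cube n)

⟨_,_⟩ : ∀ {n} → Cube n → Cube n → Bool
⟨ α , x ⟩ = Vec.foldr (λ _ → Bool) _xor_ false (Vec.zipWith _∧_ α x)

χ : ∀ {n} → Cube n → Cube n → ℚ
χ α x = if ⟨ α , x ⟩ then ℚ.- 1ℚ else 1ℚ

∑ : ∀ {n} → (Cube n → ℚ) → ℚ
∑ {n} g = foldr ℚ._+_ 0ℚ (map g (cube n))

𝔼 : ∀ {n} → (Cube n → ℚ) → ℚ
𝔼 {n} g = (_/_ (+ 1) (2 ℕ.^ n) {{m^n≢0 2 n}}) ℚ.* ∑ g

⟦_⟧ : Bool → ℚ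
⟦ false ⟧ = 0ℚ
⟦ true  ⟧ = 1ℚ

fourier : ∀ {n} → (Cube n → Bool) → Cube n → ℚ
fourier f α = 𝔼 (λ x → ⟦ f x ⟧ ℚ.* χ α x)

spectralNorm : ∀ {n} → (Cube n → Bool) → ℚ
spectralNorm f = ∑ (λ α → ℚ.∣ fourier f α ∣)

sparsity : ∀ {n} → (Cube n → Bool) → ℕ
sparsity {n} f = length (filter (λ α → ¬? (fourier f α ≟ 0ℚ)) (cube n))

data ParityDT (n : ℕ) : Set where
  leaf : Bool → ParityDT n
  node : (α : Cube n) (left right : ParityDT n) → ParityDT n

eval : ∀ {n} → ParityDT n → Cube n → Bool
eval (leaf b)     x = b
eval (node α l r) x = if ⟨ α , x ⟩ then eval r x else eval l x

depth : ∀ {n} → ParityDT n → ℕ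
depth (leaf _)     = 0
depth (node _ l r) = suc (depth l ℕ.⊔ depth r)

_Computes_ : ∀ {n} → ParityDT n → (Cube n → Bool) → Set
T Computes f = ∀ x → eval T x ≡ f x

-- d ≤ q ·log₂ s is the real inequality d ≤ q · log₂ s with denominators
-- cleared and both sides exponentiated: for q = p / (1 + k) it says
-- 2 ^ (d · (1 + k)) ≤ s ^ p, where a negative power of s is moved to the left.
-- For s = 0 and q = 0 it reads d ≤ 0, i.e. 0 · log₂ 0 = 0; this is the case of
-- the zero function, whose spectral norm and sparsity both vanish.
_≤_·log₂_ : ℕ → ℚ → ℕ → Set
d ≤ mkℚ (+ p)    k _ ·log₂ s = 2 ℕ.^ (d ℕ.* suc k) ℕ.≤ s ℕ.^ p
d ≤ mkℚ -[1+ p ] k _ ·log₂ s = 2 ℕ.^ (d ℕ.* suc k) ℕ.* s ℕ.^ suc p ℕ.≤ 1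
infix 4 _≤_·log₂_

{-# OPTIONS --safe #-}
module Submission where

-- Write a for the Fourier transform of f, p = a(0) for its mean and A for its spectral norm.
-- Passing to 1 − f if necessary (which does not increase A), let p ≤ ½.  If f ≠ 0, let β ≠ 0
-- maximise b = |a(β)| and restrict f to the half of the cube on which χ_β = − sign a(β).  The
-- restriction has coefficients a(γ) ± a(γ + β), mean p − b ≤ ½, and a spectral norm smaller by
-- at least D = 1 − 2p + 2b: this comes from f² = f, i.e. ∑ a(γ) a(γ + β) = a(β).  The case β = 0
-- of that identity gives A ≥ 1 and p (1 − p) ≤ b (A − p), whence D (2A − 1) ≥ 1 and A² drops by
-- at least 1.  So k ≤ A² queries, fixed in advance, have answers that make f constant.
-- Once that happens, the coefficients of f collapse onto fibres with no fibre meeting the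
-- support in a single point, so every choice of the k answers at least halves the sparsity,
-- and one recurses.

open import Defs
open import Data.Bool.Base using (Bool; true; false; not; _xor_; _∧_; if_then_else_)
open import Data.Bool.Properties as Bool
  using (∧-comm; xor-same; xor-assoc; xor-identityʳ; not-involutive)
open import Data.Bool.Solver using (module xor-∧-Solver)
open import Data.Integer.Base as ℤ using (+_; -[1+_])
open import Data.Integer.Properties as ℤ using ()
open import Data.List.Base as List using (List; []; _∷_; _++_; length; filter)
open import Data.List.Properties using (map-∘; map-cong)
open import Data.Nat.Base as ℕ using (ℕ; zero; suc; ⌊_/2⌋)
open import Data.Nat.Coprimality as Coprime using (1-coprimeTo)
open import Data.Nat.Properties as ℕ using (m^n≢0)
open import Data.Product.Base using (∃-syntax; _×_; _,_; proj₁; proj₂)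
open import Data.Rational.Base as ℚ
  using (ℚ; mkℚ; 0ℚ; 1ℚ; ½; _+_; _*_; _-_; -_; ∣_∣; _≤_; _<_; _/_; *≤*)
open import Data.Rational.Properties as ℚ using ()
open import Data.Rational.Solver using (module +-*-Solver)
open import Data.Rational.Unnormalised.Base using (mkℚᵘ)
open import Data.Rational.Unnormalised.Properties as ℚᵘ using ()
open import Data.Sum.Base using (_⊎_; inj₁; inj₂)
open import Data.Unit.Base using (⊤; tt)
open import Data.Vec.Base as Vec using (Vec; []; _∷_; head; tail)
open import Data.Vec.Properties
  using (zipWith-comm; zipWith-assoc; zipWith-identityʳ; zipWith-identityˡ; ≡-dec)
open import Function.Base using (_∘_; id)
open import Relation.Binary.PropositionalEquality
open import Relation.Nullary.Decidable.Core using (Dec; does; yes; no; ¬?)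
open import Relation.Nullary.Negation.Core using (contradiction)
open +-*-Solver using (solve; con; _:=_; _:+_; _:*_; _:-_; :-_)

private variable n : ℕ

-- Sums over the cube.

∑-++ : {A : Set} (g : A → ℚ) (xs ys : List A) →
  List.foldr _+_ 0ℚ (List.map g (xs ++ ys)) ≡
  List.foldr _+_ 0ℚ (List.map g xs) + List.foldr _+_ 0ℚ (List.map g ys)
∑-++ g []       ys = sym (ℚ.+-identityˡ _)
∑-++ g (x ∷ xs) ys = trans (cong (_+_ (g x)) (∑-++ g xs ys)) (sym (ℚ.+-assoc (g x) _ _))

∑-suc : ∀ n (g : Cube (suc n) → ℚ) → ∑ g ≡ ∑ (λ x → g (false ∷ x)) + ∑ (λ x → g (true ∷ x))
∑-suc n g = trans (∑-++ g (List.map (false ∷_) (cube n)) _)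
  (sym (cong₂ _+_ (cong (List.foldr _+_ 0ℚ) (map-∘ (cube n)))
        (cong (List.foldr _+_ 0ℚ) (map-∘ (cube n)))))

∑-cong : {g h : Cube n → ℚ} → (∀ x → g x ≡ h x) → ∑ g ≡ ∑ h
∑-cong {n} g≗h = cong (List.foldr _+_ 0ℚ) (map-cong g≗h (cube n))

∑-zero : ∀ n → ∑ {n} (λ _ → 0ℚ) ≡ 0ℚ
∑-zero zero    = refl
∑-zero (suc n) = trans (∑-suc n _) (cong₂ _+_ (∑-zero n) (∑-zero n))

∑-+ : (g h : Cube n → ℚ) → ∑ (λ x → g x + h x) ≡ ∑ g + ∑ h
∑-+ {n} g h = go (cube n)
  where
  go : ∀ xs → List.foldr _+_ 0ℚ (List.map (λ x → g x + h x) xs) ≡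
       List.foldr _+_ 0ℚ (List.map g xs) + List.foldr _+_ 0ℚ (List.map h xs)
  go []       = refl
  go (x ∷ xs) = trans (cong (_+_ (g x + h x)) (go xs))
    (solve 4 (λ a b c d → a :+ b :+ (c :+ d) := a :+ c :+ (b :+ d)) refl (g x) (h x) _ _)

∑-* : (c : ℚ) (g : Cube n → ℚ) → ∑ (λ x → c * g x) ≡ c * ∑ g
∑-* {n} c g = go (cube n)
  where
  go : ∀ xs → List.foldr _+_ 0ℚ (List.map (λ x → c * g x) xs) ≡ c * List.foldr _+_ 0ℚ
        (List.map g xs)
  go []       = sym (ℚ.*-zeroʳ c)
  go (x ∷ xs) = trans (cong (_+_ (c * g x)) (go xs)) (sym (ℚ.*-distribˡ-+ c (g x) _))

∑-mono : {g h : Cube n → ℚ} → (∀ x → g x ≤ h x) → ∑ g ≤ ∑ h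
∑-mono {n} {g} {h} g≤h = go (cube n)
  where
  go : ∀ xs → List.foldr _+_ 0ℚ (List.map g xs) ≤ List.foldr _+_ 0ℚ (List.map h xs)
  go []       = ℚ.≤-refl
  go (x ∷ xs) = ℚ.+-mono-≤ (g≤h x) (go xs)

infixl 6 _⊕_
_⊕_ : Cube n → Cube n → Cube n
_⊕_ = Vec.zipWith _xor_

𝟘 : Cube n
𝟘 = Vec.replicate _ false

∑-shift : (δ : Cube n) (g : Cube n → ℚ) → ∑ (λ x → g (x ⊕ δ)) ≡ ∑ g
∑-shift {zero}  []          g = refl
∑-shift {suc n} (false ∷ δ) g = trans (∑-suc n _) (trans
  (cong₂ _+_ (∑-shift δ (g ∘ (false ∷_))) (∑-shift δ (g ∘ (true ∷_)))) (sym (∑-suc _ g)))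
∑-shift {suc n} (true ∷ δ)  g = trans (∑-suc n _) (trans
  (cong₂ _+_ (∑-shift δ (g ∘ (true ∷_))) (∑-shift δ (g ∘ (false ∷_))))
  (trans (ℚ.+-comm (∑ (g ∘ (true ∷_))) _) (sym (∑-suc _ g))))

-- A point mass, used as a correction term that turns an estimate valid only away from the origin
-- into one that can be summed over the whole cube.
at𝟘 : ℚ → Cube n → ℚ
at𝟘 c []          = c
at𝟘 c (false ∷ x) = at𝟘 c x
at𝟘 c (true ∷ x)  = 0ℚ

∑-at𝟘 : ∀ n (c : ℚ) → ∑ {n} (at𝟘 c) ≡ c
∑-at𝟘 zero    c = ℚ.+-identityʳ c
∑-at𝟘 (suc n) c = trans (∑-suc n (at𝟘 c)) (trans (cong₂ _+_ (∑-at𝟘 n c) (∑-zero n))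
      (ℚ.+-identityʳ c))

-- Averages over the cube and order on the rationals.

-- `_/_` normalises by a gcd that does not compute for a variable `m`; comparing unnormalised
-- fractions avoids it.
1/[2*m] : ∀ m .{{_ : ℕ.NonZero m}} .{{_ : ℕ.NonZero (2 ℕ.* m)}} → + 1 / (2 ℕ.* m) ≡ ½ * (+ 1 / m)
1/[2*m] (suc k) = ℚ.toℚᵘ-injective (ℚᵘ.≃-trans (ℚ.toℚᵘ-fromℚᵘ (mkℚᵘ (+ 1) _)) (ℚᵘ.≃-sym
  (ℚᵘ.≃-trans (ℚ.toℚᵘ-homo-* ½ (+ 1 / suc k)) (ℚᵘ.*-congˡ {ℚ.toℚᵘ ½}
        (ℚ.toℚᵘ-fromℚᵘ (mkℚᵘ (+ 1) k))))))

𝔼-suc : ∀ n (g : Cube (suc n) → ℚ) →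
  𝔼 g ≡ ½ * (𝔼 (λ x → g (false ∷ x)) + 𝔼 (λ x → g (true ∷ x)))
𝔼-suc n g = trans
  (cong₂ _*_ (1/[2*m] (2 ℕ.^ n) {{m^n≢0 2 n}} {{m^n≢0 2 (suc n)}}) (∑-suc n g))
  (solve 4 (λ h w a b → h :* w :* (a :+ b) := h :* (w :* a :+ w :* b)) refl
    ½ (_/_ (+ 1) (2 ℕ.^ n) {{m^n≢0 2 n}}) (∑ (λ x → g (false ∷ x))) (∑ (λ x → g (true ∷ x))))

0≤+ : ∀ {p q} → 0ℚ ≤ p → 0ℚ ≤ q → 0ℚ ≤ p + q
0≤+ = ℚ.+-mono-≤

0≤* : ∀ {p q} → 0ℚ ≤ p → 0ℚ ≤ q → 0ℚ ≤ p * q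
0≤* {p} {q} 0≤p 0≤q = ℚ.nonNegative⁻¹ (p * q) {{ℚ.nonNeg*nonNeg⇒nonNeg p {{ℚ.nonNegative 0≤p}} q
      {{ℚ.nonNegative 0≤q}}}}

p+r≡q⇒p≤q : ∀ {p q} r → 0ℚ ≤ r → p + r ≡ q → p ≤ q
p+r≡q⇒p≤q {p} r 0≤r refl = subst (_≤ p + r) (ℚ.+-identityʳ p) (ℚ.+-monoʳ-≤ p 0≤r)

0≤q-p : ∀ {p q} → p ≤ q → 0ℚ ≤ q - p
0≤q-p {p} {q} p≤q = subst (_≤ q - p) (ℚ.+-inverseʳ p) (ℚ.+-monoˡ-≤ (- p) p≤q)

0≤1 : 0ℚ ≤ 1ℚ
0≤1 = ℚ.nonNegative⁻¹ 1ℚ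

1/2^ : ℕ → ℚ
1/2^ n = _/_ (+ 1) (2 ℕ.^ n) {{m^n≢0 2 n}}

0≤1/2^ : ∀ n → 0ℚ ≤ 1/2^ n
0≤1/2^ n = ℚ.nonNegative⁻¹ (1/2^ n) {{ℚ.normalize-nonNeg 1 (2 ℕ.^ n) {{m^n≢0 2 n}}}}

-1*p≡-p : ∀ p → - 1ℚ * p ≡ - p
-1*p≡-p = solve 1 (λ p → con (- 1ℚ) :* p := :- p) refl

𝔼-zero : (g : Cube 0 → ℚ) → 𝔼 g ≡ g []
𝔼-zero g = trans (ℚ.*-identityˡ _) (ℚ.+-identityʳ _)

𝔼-cong : {g h : Cube n → ℚ} → (∀ x → g x ≡ h x) → 𝔼 g ≡ 𝔼 h
𝔼-cong {n} g≗h = cong (1/2^ n *_) (∑-cong g≗h)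

𝔼-+ : (g h : Cube n → ℚ) → 𝔼 (λ x → g x + h x) ≡ 𝔼 g + 𝔼 h
𝔼-+ {n} g h = trans (cong (1/2^ n *_) (∑-+ g h)) (ℚ.*-distribˡ-+ (1/2^ n) (∑ g) (∑ h))

𝔼-* : (c : ℚ) (g : Cube n → ℚ) → 𝔼 (λ x → c * g x) ≡ c * 𝔼 g
𝔼-* {n} c g = trans (cong (1/2^ n *_) (∑-* c g))
  (solve 3 (λ w c s → w :* (c :* s) := c :* (w :* s)) refl (1/2^ n) c (∑ g))

𝔼-shift : (δ : Cube n) (g : Cube n → ℚ) → 𝔼 (λ x → g (x ⊕ δ)) ≡ 𝔼 g
𝔼-shift {n} δ g = cong (1/2^ n *_) (∑-shift δ g)

𝔼-mono : {g h : Cube n → ℚ} → (∀ x → g x ≤ h x) → 𝔼 g ≤ 𝔼 h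
𝔼-mono {n} {g} {h} g≤h = ℚ.*-monoˡ-≤-nonNeg (1/2^ n) {{ℚ.nonNegative (0≤1/2^ n)}} (∑-mono g≤h)

∑-nonNeg : {g : Cube n → ℚ} → (∀ x → 0ℚ ≤ g x) → 0ℚ ≤ ∑ g
∑-nonNeg {n} {g} 0≤g = subst (_≤ ∑ g) (∑-zero n) (∑-mono 0≤g)

𝔼-nonNeg : {g : Cube n → ℚ} → (∀ x → 0ℚ ≤ g x) → 0ℚ ≤ 𝔼 g
𝔼-nonNeg {n} 0≤g = 0≤* (0≤1/2^ n) (∑-nonNeg 0≤g)

-- Both half averages are non-negative and their sum is at most 0, so neither is positive; the claim
-- descends to the half containing the point.
𝔼≤0⇒≤0 : {g : Cube n → ℚ} → (∀ x → 0ℚ ≤ g x) → 𝔼 g ≤ 0ℚ → ∀ x → g x ≤ 0ℚ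
𝔼≤0⇒≤0 {zero}      {g} 0≤g 𝔼≤0 []      = subst (_≤ 0ℚ) (𝔼-zero g) 𝔼≤0
𝔼≤0⇒≤0 {n = suc n} {g} 0≤g 𝔼≤0 (b ∷ x) = 𝔼≤0⇒≤0 (λ x → 0≤g (b ∷ x)) (half b) x
  where
  e : Bool → ℚ
  e b = 𝔼 (λ x → g (b ∷ x))

  0≤e : ∀ b → 0ℚ ≤ e b
  0≤e b = 𝔼-nonNeg (λ x → 0≤g (b ∷ x))

  total : ½ * (e false + e true) ≤ ½ * 0ℚ
  total = subst (_≤ 0ℚ) (𝔼-suc n g) 𝔼≤0

  half : ∀ b → e b ≤ 0ℚ
  half false = ℚ.≤-trans (p+r≡q⇒p≤q _ (0≤e true) refl) (ℚ.*-cancelˡ-≤-pos ½ total)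
  half true  = ℚ.≤-trans (p+r≡q⇒p≤q _ (0≤e false) (ℚ.+-comm (e true) (e false)))
        (ℚ.*-cancelˡ-≤-pos ½ total)

-- Signs, characters and the Fourier transform.

sgn : Bool → ℚ
sgn b = if b then - 1ℚ else 1ℚ

sgn-xor : ∀ b c → sgn (b xor c) ≡ sgn b * sgn c
sgn-xor false c     = sym (ℚ.*-identityˡ (sgn c))
sgn-xor true  false = refl
sgn-xor true  true  = refl

⟨⟩-comm : (x y : Cube n) → ⟨ x , y ⟩ ≡ ⟨ y , x ⟩
⟨⟩-comm x y = cong (Vec.foldr (λ _ → Bool) _xor_ false) (zipWith-comm ∧-comm x y)

⟨⟩-⊕ˡ : (α β x : Cube n) → ⟨ α ⊕ β , x ⟩ ≡ ⟨ α , x ⟩ xor ⟨ β , x ⟩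
⟨⟩-⊕ˡ []      []      []      = refl
⟨⟩-⊕ˡ (a ∷ α) (b ∷ β) (c ∷ x) = trans (cong (((a xor b) ∧ c) xor_) (⟨⟩-⊕ˡ α β x))
  (B.solve 5 (λ a b c p q → ((a B.:+ b) B.:* c) B.:+ (p B.:+ q) B.:= ((a B.:* c) B.:+ p) B.:+
        ((b B.:* c) B.:+ q))
    refl a b c ⟨ α , x ⟩ ⟨ β , x ⟩)
  where module B = xor-∧-Solver

⟨⟩-⊕ʳ : (α x y : Cube n) → ⟨ α , x ⊕ y ⟩ ≡ ⟨ α , x ⟩ xor ⟨ α , y ⟩
⟨⟩-⊕ʳ α x y = trans (⟨⟩-comm α (x ⊕ y)) (trans (⟨⟩-⊕ˡ x y α)
      (cong₂ _xor_ (⟨⟩-comm x α) (⟨⟩-comm y α)))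

⟨𝟘,_⟩ : (x : Cube n) → ⟨ 𝟘 , x ⟩ ≡ false
⟨𝟘, [] ⟩    = refl
⟨𝟘, b ∷ x ⟩ = ⟨𝟘, x ⟩

χ-⊕ˡ : (α β x : Cube n) → χ (α ⊕ β) x ≡ χ α x * χ β x
χ-⊕ˡ α β x = trans (cong sgn (⟨⟩-⊕ˡ α β x)) (sgn-xor ⟨ α , x ⟩ ⟨ β , x ⟩)

χ-⊕ʳ : (α x y : Cube n) → χ α (x ⊕ y) ≡ χ α x * χ α y
χ-⊕ʳ α x y = trans (cong sgn (⟨⟩-⊕ʳ α x y)) (sgn-xor ⟨ α , x ⟩ ⟨ α , y ⟩)

χ-𝟘 : (x : Cube n) → χ 𝟘 x ≡ 1ℚ
χ-𝟘 x = cong sgn ⟨𝟘, x ⟩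

-- `fourier f` unfolds to the case `⟦_⟧ ∘ f`. Rational values are allowed so that products of
-- functions stay within one notion.
transform : (Cube n → ℚ) → Cube n → ℚ
transform F α = 𝔼 (λ x → F x * χ α x)

transform-false : ∀ n (F : Cube (suc n) → ℚ) α → transform F (false ∷ α) ≡
  ½ * (transform (F ∘ (false ∷_)) α + transform (F ∘ (true ∷_)) α)
transform-false n F α = 𝔼-suc n (λ x → F x * χ (false ∷ α) x)

transform-true : ∀ n (F : Cube (suc n) → ℚ) α → transform F (true ∷ α) ≡
  ½ * (transform (F ∘ (false ∷_)) α - transform (F ∘ (true ∷_)) α)
transform-true n F α = trans (𝔼-suc n (λ x → F x * χ (true ∷ α) x))
  (cong (λ e → ½ * (transform (F ∘ (false ∷_)) α + e))
    (trans (𝔼-cong flip) (trans (𝔼-* (- 1ℚ) (λ x → F (true ∷ x) * χ α x))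
          (-1*p≡-p (transform (F ∘ (true ∷_)) α)))))
  where
  flip : ∀ x → F (true ∷ x) * χ (true ∷ α) (true ∷ x) ≡ - 1ℚ * (F (true ∷ x) * χ α x)
  flip x = trans (cong (F (true ∷ x) *_) (sgn-xor true ⟨ α , x ⟩))
    (solve 2 (λ f e → f :* (con (- 1ℚ) :* e) := con (- 1ℚ) :* (f :* e)) refl (F (true ∷ x)) (χ α x))

-- Splitting off the first coordinate writes each coefficient as half a sum or half a difference of
-- coefficients on the two half cubes. The mixed products cancel, and induction applies to each
-- half.
transform-convolution : (F G : Cube n → ℚ) (δ : Cube n) →
  ∑ (λ γ → transform F γ * transform G (γ ⊕ δ)) ≡ transform (λ x → F x * G x) δ
transform-convolution {zero} F G [] = trans (ℚ.+-identityʳ _) (trans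
  (cong₂ _*_ (𝔼-zero (λ x → F x * χ [] x)) (𝔼-zero (λ x → G x * χ [] x)))
  (trans (solve 2 (λ f g → (f :* con 1ℚ) :* (g :* con 1ℚ) := (f :* g) :* con 1ℚ) refl (F []) (G []))
    (sym (𝔼-zero (λ x → (F x * G x) * χ [] x)))))
transform-convolution {suc n} F G (d ∷ δ) = trans (∑-suc n _) (trans (sym (∑-+
  (λ γ → transform F (false ∷ γ) * transform G ((false ∷ γ) ⊕ (d ∷ δ)))
  (λ γ → transform F (true ∷ γ) * transform G ((true ∷ γ) ⊕ (d ∷ δ))))) (finish d))
  where
  a c : Bool → Cube n → ℚ
  a b = transform (F ∘ (b ∷_))
  c b γ = transform (G ∘ (b ∷_)) (γ ⊕ δ)

  p : Bool → Cube n → ℚ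
  p b γ = a b γ * c b γ

  IH : ∀ b → ∑ (p b) ≡ transform (λ x → F (b ∷ x) * G (b ∷ x)) δ
  IH b = transform-convolution (F ∘ (b ∷_)) (G ∘ (b ∷_)) δ

  finish : ∀ d → ∑ (λ γ → transform F (false ∷ γ) * transform G ((false ∷ γ) ⊕ (d ∷ δ)) +
                          transform F (true ∷ γ) * transform G ((true ∷ γ) ⊕ (d ∷ δ))) ≡
                 transform (λ x → F x * G x) (d ∷ δ)
  finish false = trans (∑-cong λ γ → trans
      (cong₂ _+_ (cong₂ _*_ (transform-false n F γ) (transform-false n G (γ ⊕ δ)))
                 (cong₂ _*_ (transform-true n F γ) (transform-true n G (γ ⊕ δ))))
      (solve 4 (λ a b c d → con ½ :* (a :+ b) :* (con ½ :* (c :+ d)) :+ con ½ :* (a :- b) :*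
            (con ½ :* (c :- d))
                         := con ½ :* (a :* c :+ b :* d)) refl (a false γ) (a true γ) (c false γ)
                               (c true γ)))
    (trans (∑-* ½ (λ γ → p false γ + p true γ)) (trans
          (cong (½ *_) (trans (∑-+ (p false) (p true)) (cong₂ _+_ (IH false) (IH true))))
      (sym (transform-false n (λ x → F x * G x) δ))))
  finish true = trans (∑-cong λ γ → trans
      (cong₂ _+_ (cong₂ _*_ (transform-false n F γ) (transform-true n G (γ ⊕ δ)))
                 (cong₂ _*_ (transform-true n F γ) (transform-false n G (γ ⊕ δ))))
      (solve 4 (λ a b c d → con ½ :* (a :+ b) :* (con ½ :* (c :- d)) :+ con ½ :* (a :- b) :*
            (con ½ :* (c :+ d))
                         := con ½ :* (a :* c :+ con (- 1ℚ) :* (b :* d))) refl (a false γ)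
                               (a true γ) (c false γ) (c true γ)))
    (trans (∑-* ½ (λ γ → p false γ + - 1ℚ * p true γ))
          (trans (cong (½ *_) (trans (∑-+ (p false) (λ γ → - 1ℚ * p true γ)) (cong₂ _+_ (IH false)
        (trans (∑-* (- 1ℚ) (p true)) (trans (-1*p≡-p (∑ (p true))) (cong -_ (IH true)))))))
      (sym (transform-true n (λ x → F x * G x) δ))))

-- Restriction to a half of the cube.

-- When ⟨β,v⟩ = 1 this is the projection along v onto the half of the cube where ⟨β,x⟩ = c, so
-- f ∘ move β v c is the restriction of f to that half, extended v-periodically.
move : (β v : Cube n) → Bool → Cube n → Cube n
move β v c x = if ⟨ β , x ⟩ xor c then x ⊕ v else x

-- A `v`-periodic function has no coefficient at `γ` unless `γ` is orthogonal to `v`. On the half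
-- cube `χ β` is the constant `sgn c`, so the characters of `γ` and `γ ⊕ β` agree there up to that
-- sign and their coefficients merge.
restricted : (β v : Cube n) → Bool → (Cube n → ℚ) → Cube n → ℚ
restricted β v c a γ = if ⟨ γ , v ⟩ then 0ℚ else a γ + sgn c * a (γ ⊕ β)

-- `K` is `F` times `χ γ`, cut down to the half cube by the factor (1 + sgn c · χ β) / 2. Exactly
-- one of `x` and `x ⊕ v` lies in that half, so the two terms of `pointwise` give the restricted
-- function, and shift invariance evaluates their averages.
transform-move : (β v : Cube n) → ⟨ β , v ⟩ ≡ true → (c : Bool) (F : Cube n → ℚ) (γ : Cube n) →
  transform (F ∘ move β v c) γ ≡ restricted β v c (transform F) γ
transform-move {n} β v βv c F γ = trans (𝔼-cong pointwise) (trans (𝔼-+ K (λ x → χ γ v * K (x ⊕ v)))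
  (trans (cong (_+_ (𝔼 K)) (trans (𝔼-* (χ γ v) (λ x → K (x ⊕ v))) (cong (χ γ v *_) (𝔼-shift v K))))
        (finish ⟨ γ , v ⟩)))
  where
  K : Cube n → ℚ
  K y = ½ * (F y * χ γ y + sgn c * (F y * χ (γ ⊕ β) y))

  L M : Cube n → ℚ
  L x = F x * χ γ x
  M x = F x * χ (γ ⊕ β) x

  𝔼K : 𝔼 K ≡ ½ * (transform F γ + sgn c * transform F (γ ⊕ β))
  𝔼K = trans (𝔼-* ½ (λ x → L x + sgn c * M x)) (cong (½ *_)
    (trans (𝔼-+ L (λ x → sgn c * M x)) (cong (_+_ (transform F γ)) (𝔼-* (sgn c) M))))

  finish : ∀ t → 𝔼 K + sgn t * 𝔼 K ≡ (if t then 0ℚ else transform F γ + sgn c * transform F (γ ⊕ β))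
  finish false = trans (cong (λ e → e + 1ℚ * e) 𝔼K)
    (solve 1 (λ e → con ½ :* e :+ con 1ℚ :* (con ½ :* e) := e) refl
          (transform F γ + sgn c * transform F (γ ⊕ β)))
  finish true  = solve 1 (λ e → e :+ con (- 1ℚ) :* e := con 0ℚ) refl (𝔼 K)

  -- Branching is written as a polynomial in the sign, so that the ring solver can finish.
  choose : ∀ b u w → (if b then u else w) ≡ ½ * ((1ℚ + sgn b) * w + (1ℚ - sgn b) * u)
  choose false = solve 2 (λ u w → w := con ½ :* ((con 1ℚ :+ con 1ℚ) :* w :+ (con 1ℚ :- con 1ℚ) :*
        u)) refl
  choose true  = solve 2 (λ u w → u := con ½ :* ((con 1ℚ :+ con (- 1ℚ)) :* w :+
        (con 1ℚ :- con (- 1ℚ)) :* u)) refl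

  sgn² : ∀ b → sgn b * sgn b ≡ 1ℚ
  sgn² false = refl
  sgn² true  = refl

  -- Here `s`, `t`, `e` stand for ⟨β,x⟩, ⟨γ,v⟩ and `χ γ x`. The factor `- 1ℚ` is `χ β v`, and
  -- `sgn² t` lets the sign `χ γ v` be inserted twice.
  combine : ∀ s c t e u w → (if s xor c then u else w) * e ≡
    ½ * (w * e + sgn c * (w * (e * sgn s))) +
    sgn t * (½ * (u * (e * sgn t) + sgn c * (u * (e * sgn t * (sgn s * - 1ℚ)))))
  combine s c t e u w = trans
    (cong (_* e) (trans (choose (s xor c) u w) (cong (λ z → ½ * ((1ℚ + z) * w + (1ℚ - z) * u))
          (sgn-xor s c))))
    (trans
      (solve 5 (λ s c e u w → con ½ :* ((con 1ℚ :+ s :* c) :* w :+ (con 1ℚ :- s :* c) :* u) :* e :=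
        con ½ :* (w :* e :+ c :* (w :* (e :* s))) :+ con 1ℚ :*
              (con ½ :* (u :* e :- c :* (u :* (e :* s)))))
        refl (sgn s) (sgn c) e u w)
      (trans (cong (λ z → ½ * (w * e + sgn c * (w * (e * sgn s))) + z *
            (½ * (u * e - sgn c * (u * (e * sgn s)))))
               (sym (sgn² t)))
        (solve 6 (λ s c t e u w →
          con ½ :* (w :* e :+ c :* (w :* (e :* s))) :+ t :* t :*
                (con ½ :* (u :* e :- c :* (u :* (e :* s)))) :=
          con ½ :* (w :* e :+ c :* (w :* (e :* s))) :+
          t :* (con ½ :* (u :* (e :* t) :+ c :* (u :* (e :* t :* (s :* con (- 1ℚ)))))))
          refl (sgn s) (sgn c) (sgn t) e u w)))

  float : ∀ b (x y : Cube n) → F (if b then x else y) ≡ (if b then F x else F y)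
  float false x y = refl
  float true  x y = refl

  pointwise : ∀ x → F (move β v c x) * χ γ x ≡ K x + χ γ v * K (x ⊕ v)
  pointwise x rewrite float (⟨ β , x ⟩ xor c) (x ⊕ v) x
    | χ-⊕ˡ γ β x | χ-⊕ˡ γ β (x ⊕ v) | χ-⊕ʳ γ x v | χ-⊕ʳ β x v | βv
    = combine ⟨ β , x ⟩ c ⟨ γ , v ⟩ (χ γ x) (F (x ⊕ v)) (F x)

-- Points of the cube and scalar inequalities.

2ℚ : ℚ
2ℚ = 1ℚ + 1ℚ

0≤2 : 0ℚ ≤ 2ℚ
0≤2 = ℚ.nonNegative⁻¹ 2ℚ

_≟𝟘 : (γ : Cube n) → Dec (γ ≡ 𝟘)
γ ≟𝟘 = ≡-dec Bool._≟_ γ 𝟘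

at𝟘-𝟘 : ∀ n c → at𝟘 {n} c 𝟘 ≡ c
at𝟘-𝟘 zero    c = refl
at𝟘-𝟘 (suc n) c = at𝟘-𝟘 n c

at𝟘-≢ : ∀ {c} (γ : Cube n) → γ ≢ 𝟘 → at𝟘 c γ ≡ 0ℚ
at𝟘-≢ []          γ≢𝟘 = contradiction refl γ≢𝟘
at𝟘-≢ (false ∷ γ) γ≢𝟘 = at𝟘-≢ γ (γ≢𝟘 ∘ cong (false ∷_))
at𝟘-≢ (true ∷ γ)  γ≢𝟘 = refl

⊕-identityˡ : (γ : Cube n) → 𝟘 ⊕ γ ≡ γ
⊕-identityˡ = zipWith-identityˡ (λ _ → refl)

⊕-identityʳ : (γ : Cube n) → γ ⊕ 𝟘 ≡ γ
⊕-identityʳ = zipWith-identityʳ xor-identityʳ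

⊕-self : (β : Cube n) → β ⊕ β ≡ 𝟘
⊕-self []      = refl
⊕-self (b ∷ β) = cong₂ _∷_ (xor-same b) (⊕-self β)

⊕-cancel : (γ β : Cube n) → γ ⊕ β ⊕ β ≡ γ
⊕-cancel γ β = trans (zipWith-assoc xor-assoc γ β β)
      (trans (cong (γ ⊕_) (⊕-self β)) (⊕-identityʳ γ))

argmax : (h : Cube n → ℚ) → ∃[ β ] (∀ γ → h γ ≤ h β)
argmax {zero}  h = [] , λ { [] → ℚ.≤-refl }
argmax {suc n} h with argmax (h ∘ (false ∷_)) | argmax (h ∘ (true ∷_))
... | β₀ , max₀ | β₁ , max₁ with ℚ.≤-total (h (false ∷ β₀)) (h (true ∷ β₁))
... | inj₁ le = true ∷ β₁ , λ { (false ∷ γ) → ℚ.≤-trans (max₀ γ) le ; (true ∷ γ) → max₁ γ }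
... | inj₂ ge = false ∷ β₀ , λ { (false ∷ γ) → max₀ γ ; (true ∷ γ) → ℚ.≤-trans (max₁ γ) ge }

⟨⟩-nondegenerate : (β : Cube n) → β ≢ 𝟘 → ∃[ v ] ⟨ β , v ⟩ ≡ true
⟨⟩-nondegenerate []          β≢𝟘 = contradiction refl β≢𝟘
⟨⟩-nondegenerate (true ∷ β)  β≢𝟘 = true ∷ 𝟘 , cong not (trans (⟨⟩-comm β 𝟘) ⟨𝟘, β ⟩)
⟨⟩-nondegenerate (false ∷ β) β≢𝟘 with ⟨⟩-nondegenerate β (β≢𝟘 ∘ cong (false ∷_))
... | v , βv = false ∷ v , βv

∣p∣²≡p² : ∀ p → ∣ p ∣ * ∣ p ∣ ≡ p * p
∣p∣²≡p² p with ℚ.∣p∣≡p∨∣p∣≡-p p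
... | inj₁ eq = cong₂ _*_ eq eq
... | inj₂ eq = trans (cong₂ _*_ eq eq) (solve 1 (λ p → :- p :* :- p := p :* p) refl p)

∣sgn*p∣ : ∀ c p → ∣ sgn c * p ∣ ≡ ∣ p ∣
∣sgn*p∣ c p = trans (ℚ.∣p*q∣≡∣p∣*∣q∣ (sgn c) p) (trans (cong (_* ∣ p ∣) (one c))
      (ℚ.*-identityˡ ∣ p ∣))
  where
  one : ∀ c → ∣ sgn c ∣ ≡ 1ℚ
  one false = refl
  one true  = refl

-- The loss |x| + |y| − |x + y| is bounded below by − 2xy / b, which can be summed by the
-- convolution identity.
b*[x+y]-2xy : ∀ {b} x y → ∣ x ∣ ≤ b → ∣ y ∣ ≤ b →
  b * (x + y) - 2ℚ * (x * y) ≤ b * (∣ x ∣ + ∣ y ∣)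
b*[x+y]-2xy {b} x y x≤b y≤b with ∣ x ∣ | ℚ.0≤∣p∣ x | ℚ.∣p∣≡p∨∣p∣≡-p x | ∣ y ∣ | ℚ.0≤∣p∣ y |
      ℚ.∣p∣≡p∨∣p∣≡-p y
... | _ | 0≤u | inj₁ refl | _ | 0≤w | inj₁ refl = p+r≡q⇒p≤q (2ℚ * (x * y)) (0≤* 0≤2 (0≤* 0≤u 0≤w))
  (solve 3 (λ b x y → b :* (x :+ y) :- con 2ℚ :* (x :* y) :+ con 2ℚ :* (x :* y) := b :* (x :+ y))
        refl b x y)
... | _ | 0≤u | inj₁ refl | _ | 0≤w | inj₂ refl = p+r≡q⇒p≤q (2ℚ * (- y * (b - x)))
      (0≤* 0≤2 (0≤* 0≤w (0≤q-p x≤b)))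
  (solve 3 (λ b x y → b :* (x :+ y) :- con 2ℚ :* (x :* y) :+ con 2ℚ :* (:- y :* (b :- x)) := b :*
        (x :+ :- y)) refl b x y)
... | _ | 0≤u | inj₂ refl | _ | 0≤w | inj₁ refl = p+r≡q⇒p≤q (2ℚ * (- x * (b - y)))
      (0≤* 0≤2 (0≤* 0≤u (0≤q-p y≤b)))
  (solve 3 (λ b x y → b :* (x :+ y) :- con 2ℚ :* (x :* y) :+ con 2ℚ :* (:- x :* (b :- y)) := b :*
        (:- x :+ y)) refl b x y)
... | _ | 0≤u | inj₂ refl | _ | 0≤w | inj₂ refl = p+r≡q⇒p≤q (2ℚ * (b * (- x + - y) + - x * - y))
  (0≤* 0≤2 (0≤+ (0≤* (ℚ.≤-trans 0≤u x≤b) (0≤+ 0≤u 0≤w)) (0≤* 0≤u 0≤w)))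
  (solve 3 (λ b x y → b :* (x :+ y) :- con 2ℚ :* (x :* y) :+ con 2ℚ :*
        (b :* (:- x :+ :- y) :+ :- x :* :- y) := b :* (:- x :+ :- y)) refl b x y)

-- Replacing `x` and `y` by their negatives changes neither the product nor the absolute values, so
-- the sum may be taken to equal its absolute value.
b*∣x+y∣-2xy : ∀ {b} x y → ∣ x ∣ ≤ b → ∣ y ∣ ≤ b →
  b * ∣ x + y ∣ - 2ℚ * (x * y) ≤ b * (∣ x ∣ + ∣ y ∣)
b*∣x+y∣-2xy {b} x y x≤b y≤b with ℚ.∣p∣≡p∨∣p∣≡-p (x + y)
... | inj₁ eq = subst (λ s → b * s - 2ℚ * (x * y) ≤ b * (∣ x ∣ + ∣ y ∣)) (sym eq)
      (b*[x+y]-2xy x y x≤b y≤b)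
... | inj₂ eq = subst₂ _≤_
  (trans (solve 3 (λ b x y → b :* (:- x :+ :- y) :- con 2ℚ :* (:- x :* :- y) := b :* (:- (x :+ y))
        :- con 2ℚ :* (x :* y)) refl b x y)
    (cong (λ s → b * s - 2ℚ * (x * y)) (sym eq)))
  (cong₂ (λ u w → b * (u + w)) (ℚ.∣-p∣≡∣p∣ x) (ℚ.∣-p∣≡∣p∣ y))
  (b*[x+y]-2xy (- x) (- y) (subst (_≤ b) (sym (ℚ.∣-p∣≡∣p∣ x)) x≤b)
        (subst (_≤ b) (sym (ℚ.∣-p∣≡∣p∣ y)) y≤b))

≤⇒²≤² : ∀ {p q} → 0ℚ ≤ p → p ≤ q → p * p ≤ q * q
≤⇒²≤² {p} {q} 0≤p p≤q = ℚ.≤-trans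
  (ℚ.*-monoˡ-≤-nonNeg p {{ℚ.nonNegative 0≤p}} p≤q)
  (ℚ.*-monoʳ-≤-nonNeg q {{ℚ.nonNegative (ℚ.≤-trans 0≤p p≤q)}} p≤q)

-- A² - (A - D)² = D (2A - D), and `D ≤ 1ℚ` makes this at least D (2A - 1).
square-drop : ∀ {A D} → 0ℚ ≤ D → D ≤ 1ℚ → 1ℚ ≤ D * (2ℚ * A - 1ℚ) → (A - D) * (A - D) + 1ℚ ≤ A * A
square-drop {A} {D} 0≤D D≤1 1≤ = p+r≡q⇒p≤q ((D * (2ℚ * A - 1ℚ) - 1ℚ) + D * (1ℚ - D))
  (0≤+ (0≤q-p 1≤) (0≤* 0≤D (0≤q-p D≤1)))
  (solve 2 (λ A D → (A :- D) :* (A :- D) :+ con 1ℚ :+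
        ((D :* (con 2ℚ :* A :- con 1ℚ) :- con 1ℚ) :+ D :* (con 1ℚ :- D)) := A :* A)
    refl A D)

-- With D = 1 - 2p + 2b, the difference D (2A - 1) - 1 equals 4 (b (A - p) - p (1 - p)) + 2 (1 - 2p)
-- ((A - 1) + (p - b)), and both summands are non-negative.
drop-bound : ∀ {p b A} → p ≤ ½ → b ≤ p → p * (1ℚ - p) ≤ b * (A - p) → 1ℚ ≤ A →
  1ℚ ≤ (2ℚ * (½ - p) + 2ℚ * b) * (2ℚ * A - 1ℚ)
drop-bound {p} {b} {A} p≤½ b≤p var 1≤A = p+r≡q⇒p≤q
  (2ℚ * 2ℚ * (b * (A - p) - p * (1ℚ - p)) + 2ℚ * (2ℚ * (½ - p)) * ((A - 1ℚ) + (p - b)))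
  (0≤+ (0≤* (0≤* 0≤2 0≤2) (0≤q-p var))
       (0≤* (0≤* 0≤2 (0≤* 0≤2 (0≤q-p p≤½))) (0≤+ (0≤q-p 1≤A) (0≤q-p b≤p))))
  (solve 3 (λ p b A →
    con 1ℚ :+ (con 2ℚ :* con 2ℚ :* (b :* (A :- p) :- p :* (con 1ℚ :- p)) :+ con 2ℚ :*
          (con 2ℚ :* (con ½ :- p)) :* ((A :- con 1ℚ) :+ (p :- b)))
     := (con 2ℚ :* (con ½ :- p) :+ con 2ℚ :* b) :* (con 2ℚ :* A :- con 1ℚ)) refl p b A)

-- Cosets of a direction and the spectrum of a Boolean function.

fold : (β v : Cube n) → (Cube n → ℚ) → Cube n → ℚ
fold β v w γ = if ⟨ γ , v ⟩ then 0ℚ else w γ + w (γ ⊕ β)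

-- Each pair `γ`, `γ ⊕ β` has exactly one member orthogonal to `v`; `fold` places the weight of the
-- whole pair there.
∑-fold : (β v : Cube n) → ⟨ β , v ⟩ ≡ true → (w : Cube n → ℚ) → ∑ (fold β v w) ≡ ∑ w
∑-fold {n} β v βv w = trans (∑-cong split) (trans (∑-+ outside (λ γ → inside (γ ⊕ β)))
  (trans (cong (_+_ (∑ outside)) (∑-shift β inside))
        (trans (sym (∑-+ outside inside)) (∑-cong join))))
  where
  inside outside : Cube n → ℚ
  inside  γ = if ⟨ γ , v ⟩ then w γ else 0ℚ
  outside γ = if ⟨ γ , v ⟩ then 0ℚ else w γ

  split : ∀ γ → fold β v w γ ≡ outside γ + inside (γ ⊕ β)
  split γ rewrite ⟨⟩-⊕ˡ γ β v | βv with ⟨ γ , v ⟩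
  ... | false = refl
  ... | true  = refl

  join : ∀ γ → outside γ + inside γ ≡ w γ
  join γ with ⟨ γ , v ⟩
  ... | false = ℚ.+-identityʳ (w γ)
  ... | true  = ℚ.+-identityˡ (w γ)

fourier-move : (β v : Cube n) → ⟨ β , v ⟩ ≡ true → (c : Bool) (f : Cube n → Bool) (γ : Cube n) →
  fourier (f ∘ move β v c) γ ≡ restricted β v c (fourier f) γ
fourier-move β v βv c f = transform-move β v βv c (⟦_⟧ ∘ f)

-- The triangle inequality on each pair of merged frequencies.
spectralNorm-move : (β v : Cube n) → ⟨ β , v ⟩ ≡ true → (c : Bool) (f : Cube n → Bool) →
  spectralNorm (f ∘ move β v c) ≤ spectralNorm f
spectralNorm-move β v βv c f = subst (spectralNorm (f ∘ move β v c) ≤_)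
  (∑-fold β v βv (λ γ → ∣ fourier f γ ∣)) (∑-mono pointwise)
  where
  bound : ∀ t a a′ → ∣ (if t then 0ℚ else a + sgn c * a′) ∣ ≤ (if t then 0ℚ else ∣ a ∣ + ∣ a′ ∣)
  bound true  a a′ = ℚ.≤-refl
  bound false a a′ = subst (∣ a + sgn c * a′ ∣ ≤_) (cong (_+_ ∣ a ∣) (∣sgn*p∣ c a′))
        (ℚ.∣p+q∣≤∣p∣+∣q∣ a (sgn c * a′))

  pointwise : ∀ γ → ∣ fourier (f ∘ move β v c) γ ∣ ≤ fold β v (λ γ → ∣ fourier f γ ∣) γ
  pointwise γ = subst (λ e → ∣ e ∣ ≤ fold β v (λ γ → ∣ fourier f γ ∣) γ)
        (sym (fourier-move β v βv c f γ))
    (bound ⟨ γ , v ⟩ (fourier f γ) (fourier f (γ ⊕ β)))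

fourier-convolution : (f : Cube n → Bool) (δ : Cube n) →
  ∑ (λ γ → fourier f γ * fourier f (γ ⊕ δ)) ≡ fourier f δ
fourier-convolution f δ = trans (transform-convolution (⟦_⟧ ∘ f) (⟦_⟧ ∘ f) δ)
  (𝔼-cong λ x → cong (_* χ δ x) (idempotent (f x)))
  where
  idempotent : ∀ b → ⟦ b ⟧ * ⟦ b ⟧ ≡ ⟦ b ⟧
  idempotent false = refl
  idempotent true  = refl

∣fourier∣≤mean : (f : Cube n → Bool) (γ : Cube n) → ∣ fourier f γ ∣ ≤ fourier f 𝟘
∣fourier∣≤mean f γ with ℚ.∣p∣≡p∨∣p∣≡-p (fourier f γ)
... | inj₁ eq = subst (_≤ fourier f 𝟘) (sym eq) (𝔼-mono λ x →
  subst (λ e → ⟦ f x ⟧ * χ γ x ≤ ⟦ f x ⟧ * e) (sym (χ-𝟘 x)) (bound (f x) ⟨ γ , x ⟩))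
  where
  bound : ∀ b c → ⟦ b ⟧ * sgn c ≤ ⟦ b ⟧ * 1ℚ
  bound false false = ℚ.≤-refl
  bound false true  = ℚ.≤-refl
  bound true  false = ℚ.≤-refl
  bound true  true  = ℚ.≤ᵇ⇒≤ _
... | inj₂ eq = subst (_≤ fourier f 𝟘)
  (trans (𝔼-* (- 1ℚ) (λ x → ⟦ f x ⟧ * χ γ x)) (trans
        (-1*p≡-p (fourier f γ)) (sym eq)))
  (𝔼-mono λ x → subst (λ e → - 1ℚ * (⟦ f x ⟧ * χ γ x) ≤ ⟦ f x ⟧ * e) (sym (χ-𝟘 x))
        (bound (f x) ⟨ γ , x ⟩))
  where
  bound : ∀ b c → - 1ℚ * (⟦ b ⟧ * sgn c) ≤ ⟦ b ⟧ * 1ℚ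
  bound false false = ℚ.≤-refl
  bound false true  = ℚ.≤-refl
  bound true  false = ℚ.≤ᵇ⇒≤ _
  bound true  true  = ℚ.≤-refl

0≤mean : (f : Cube n → Bool) → 0ℚ ≤ fourier f 𝟘
0≤mean f = ℚ.≤-trans (ℚ.0≤∣p∣ (fourier f 𝟘)) (∣fourier∣≤mean f 𝟘)

mean≤0⇒false : (f : Cube n → Bool) → fourier f 𝟘 ≤ 0ℚ → ∀ x → f x ≡ false
mean≤0⇒false f p≤0 x = value (f x) (subst (λ e → ⟦ f x ⟧ * e ≤ 0ℚ) (χ-𝟘 x) (𝔼≤0⇒≤0 0≤term p≤0 x))
  where
  nonNeg : ∀ b → 0ℚ ≤ ⟦ b ⟧ * 1ℚ
  nonNeg false = ℚ.≤-refl
  nonNeg true  = 0≤1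

  0≤term : ∀ x → 0ℚ ≤ ⟦ f x ⟧ * χ 𝟘 x
  0≤term x = subst (λ e → 0ℚ ≤ ⟦ f x ⟧ * e) (sym (χ-𝟘 x)) (nonNeg (f x))

  value : ∀ b → ⟦ b ⟧ * 1ℚ ≤ 0ℚ → b ≡ false
  value false _   = refl
  value true  1≤0 = contradiction (ℚ.≤-antisym 1≤0 0≤1) λ ()

transform-one : (γ : Cube n) → transform (λ _ → 1ℚ) γ ≡ at𝟘 1ℚ γ
transform-one []          = 𝔼-zero (λ x → 1ℚ * χ [] x)
transform-one {suc n} (false ∷ γ) = trans (transform-false n (λ _ → 1ℚ) γ)
  (trans (solve 1 (λ q → con ½ :* (q :+ q) := q) refl (transform (λ _ → 1ℚ) γ)) (transform-one γ))
transform-one {suc n} (true ∷ γ)  = trans (transform-true n (λ _ → 1ℚ) γ)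
  (solve 1 (λ q → con ½ :* (q :- q) := con 0ℚ) refl (transform (λ _ → 1ℚ) γ))

fourier-not : (f : Cube n → Bool) (γ : Cube n) → fourier (not ∘ f) γ ≡ at𝟘 1ℚ γ - fourier f γ
fourier-not f γ = trans (𝔼-cong λ x → flip (f x) (χ γ x))
      (trans (𝔼-+ (λ x → 1ℚ * χ γ x) (λ x → - 1ℚ * (⟦ f x ⟧ * χ γ x)))
  (cong₂ _+_ (transform-one γ) (trans (𝔼-* (- 1ℚ) (λ x → ⟦ f x ⟧ * χ γ x))
    (-1*p≡-p (fourier f γ)))))
  where
  flip : ∀ b e → ⟦ not b ⟧ * e ≡ 1ℚ * e + - 1ℚ * (⟦ b ⟧ * e)
  flip false = solve 1 (λ e → con 1ℚ :* e := con 1ℚ :* e :+ con (- 1ℚ) :* (con 0ℚ :* e)) refl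
  flip true  = solve 1 (λ e → con 0ℚ :* e := con 1ℚ :* e :+ con (- 1ℚ) :* (con 1ℚ :* e)) refl

-- Parseval's identity, where f² = f turns the mean square into the mean.
∑-self-convolution : (f : Cube n → Bool) → ∑ (λ γ → fourier f γ * fourier f γ) ≡ fourier f 𝟘
∑-self-convolution f = trans (∑-cong λ γ → cong (λ δ → fourier f γ * fourier f δ)
      (sym (⊕-identityʳ γ)))
  (fourier-convolution f 𝟘)

p²≤b*∣p∣ : ∀ {b} p → ∣ p ∣ ≤ b → p * p ≤ b * ∣ p ∣
p²≤b*∣p∣ {b} p p≤b = subst (_≤ b * ∣ p ∣) (∣p∣²≡p² p)
  (ℚ.*-monoʳ-≤-nonNeg ∣ p ∣ {{ℚ.∣-∣-nonNeg p}} p≤b)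

-- By Parseval p = ∑ a(γ)² ≤ p A, and p > 0 cancels.
1≤spectralNorm : (f : Cube n → Bool) → 0ℚ < fourier f 𝟘 → 1ℚ ≤ spectralNorm f
1≤spectralNorm f 0<p = ℚ.*-cancelˡ-≤-pos (fourier f 𝟘) {{ℚ.positive 0<p}}
  (subst₂ _≤_ (trans (∑-self-convolution f) (sym (ℚ.*-identityʳ (fourier f 𝟘))))
    (∑-* (fourier f 𝟘) (λ γ → ∣ fourier f γ ∣))
    (∑-mono λ γ → p²≤b*∣p∣ (fourier f γ) (∣fourier∣≤mean f γ)))

∣mean∣≡mean : (f : Cube n → Bool) → ∣ fourier f 𝟘 ∣ ≡ fourier f 𝟘
∣mean∣≡mean f = ℚ.0≤p⇒∣p∣≡p (0≤mean f)

-- Away from the origin the squares sum to p - p² by Parseval and the absolute values to A - p; each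
-- such square is at most `b` times the absolute value.
variance-bound : (f : Cube n → Bool) (b : ℚ) → (∀ γ → γ ≢ 𝟘 → ∣ fourier f γ ∣ ≤ b) →
  fourier f 𝟘 * (1ℚ - fourier f 𝟘) ≤ b * (spectralNorm f - fourier f 𝟘)
variance-bound {n} f b max = rearrange (fourier f 𝟘) (spectralNorm f) (subst₂ _≤_
  (∑-self-convolution f)
  (trans (∑-+ (λ γ → b * ∣ fourier f γ ∣) (at𝟘 excess))
        (cong₂ _+_ (∑-* b (λ γ → ∣ fourier f γ ∣)) (∑-at𝟘 n excess)))
  (∑-mono pointwise))
  where
  -- Makes the pointwise bound an equality at the origin, where `b` need not bound the coefficient.
  excess : ℚ
  excess = fourier f 𝟘 * fourier f 𝟘 - b * fourier f 𝟘

  rearrange : ∀ p A → p ≤ b * A + (p * p - b * p) → p * (1ℚ - p) ≤ b * (A - p)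
  rearrange p A le = subst₂ _≤_
    (solve 1 (λ p → p :+ :- (p :* p) := p :* (con 1ℚ :- p)) refl p)
    (solve 3 (λ b p A → b :* A :+ (p :* p :- b :* p) :+ :- (p :* p) := b :* (A :- p)) refl b p A)
    (ℚ.+-monoˡ-≤ (- (p * p)) le)

  pointwise : ∀ γ → fourier f γ * fourier f γ ≤ b * ∣ fourier f γ ∣ + at𝟘 excess γ
  pointwise γ with γ ≟𝟘
  ... | no γ≢𝟘 = subst (fourier f γ * fourier f γ ≤_)
    (trans (sym (ℚ.+-identityʳ (b * ∣ fourier f γ ∣)))
          (cong (_+_ (b * ∣ fourier f γ ∣)) (sym (at𝟘-≢ γ γ≢𝟘))))
    (p²≤b*∣p∣ (fourier f γ) (max γ γ≢𝟘))
  ... | yes refl = ℚ.≤-reflexive (trans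
    (solve 2 (λ b p → p :* p := b :* p :+ (p :* p :- b :* p)) refl b (fourier f 𝟘))
    (cong₂ (λ u w → b * u + w) (sym (∣mean∣≡mean f)) (sym (at𝟘-𝟘 n excess))))

-- The drop of the spectral norm.

-- Away from the origin's pair, the loss on a pair `γ`, `γ ⊕ β`, multiplied by b = |a(β)|, is at
-- least -2σ a(γ) a(γ + β). By the convolution identity these terms over all pairs sum to -σ a(β) =
-- b, a loss of 1; correcting the pair of the origin by `gain` adds 2b - 2p.
∑-restricted-drop : (a : Cube n → ℚ) (β v : Cube n) → ⟨ β , v ⟩ ≡ true → (c : Bool) →
  ∑ (λ γ → a γ * a (γ ⊕ β)) ≡ a β → (∀ γ → γ ≢ 𝟘 → ∣ a γ ∣ ≤ ∣ a β ∣) → ∣ a β ∣ ≤ a 𝟘 →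
  0ℚ < ∣ a β ∣ →
  sgn c * a β ≡ - ∣ a β ∣ →
  ∑ (λ γ → ∣ restricted β v c a γ ∣) + (2ℚ * (½ - a 𝟘) + 2ℚ * ∣ a β ∣) ≤ ∑ (λ γ → ∣ a γ ∣)
∑-restricted-drop {n} a β v βv c conv max b≤p 0<b σaβ = ℚ.*-cancelˡ-≤-pos b {{ℚ.positive 0<b}}
  (subst₂ _≤_ sum-left (trans (∑-* b (fold β v ∣a∣)) (cong (b *_) (∑-fold β v βv ∣a∣)))
        (∑-mono pointwise))
  where
  ∣a∣ ∣a′∣ w : Cube n → ℚ
  ∣a∣ γ = ∣ a γ ∣
  ∣a′∣ γ = ∣ restricted β v c a γ ∣
  w γ = a γ * a (γ ⊕ β)

  p b σ gain : ℚ
  p = a 𝟘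
  b = ∣ a β ∣
  σ = sgn c
  -- On the pair of the origin `b` times the loss is exactly 2b², while the convolution term counts
  -- 2pb there.
  gain = 2ℚ * (b * b) - 2ℚ * (p * b)

  left : Cube n → ℚ
  left γ = b * ∣a′∣ γ + (at𝟘 gain γ + - σ * fold β v w γ)

  sum-left : ∑ left ≡ b * (∑ ∣a′∣ + (2ℚ * (½ - p) + 2ℚ * b))
  sum-left = trans (∑-+ (λ γ → b * ∣a′∣ γ) (λ γ → at𝟘 gain γ + - σ * fold β v w γ))
    (trans (cong₂ _+_ (∑-* b ∣a′∣) (trans (∑-+ (at𝟘 gain) (λ γ → - σ * fold β v w γ))
      (cong₂ _+_ (∑-at𝟘 n gain) (trans (∑-* (- σ) (fold β v w))
        (trans (cong (- σ *_) (trans (∑-fold β v βv w) conv))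
          (trans (sym (ℚ.neg-distribˡ-* σ (a β))) (cong -_ σaβ)))))))
      (solve 3 (λ p b A → b :* A :+ ((con 2ℚ :* (b :* b) :- con 2ℚ :* (p :* b)) :+ :- (:- b)) :=
        b :* (A :+ (con 2ℚ :* (con ½ :- p) :+ con 2ℚ :* b))) refl p b (∑ ∣a′∣)))

  -- `x′` stands for a(γ ⊕ β ⊕ β), which equals `x` only propositionally; `⊕-cancel` reconciles the
  -- two at the end.
  Bound : Bool → (z x y x′ : ℚ) → Set
  Bound t z x y x′ = b * ∣ (if t then 0ℚ else x + σ * y) ∣ +
        (z + - σ * (if t then 0ℚ else x * y + y * x′)) ≤
                     b * (if t then 0ℚ else ∣ x ∣ + ∣ y ∣)

  bound-𝟘 : ∀ p y → 0ℚ ≤ p → ∣ y ∣ ≤ p → σ * y ≡ - ∣ y ∣ → b ≡ ∣ y ∣ →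
    Bound false (2ℚ * (b * b) - 2ℚ * (p * b)) p y p
  bound-𝟘 p y 0≤p y≤p σy b≡ = ℚ.≤-reflexive (trans
    (cong₂ (λ u w → b * u + ((2ℚ * (b * b) - 2ℚ * (p * b)) + w)) ∣p-b∣
      (trans (solve 3 (λ σ p y → :- σ :* (p :* y :+ y :* p) := con 2ℚ :* p :* :- (σ :* y)) refl σ p
            y)
             (cong (λ e → 2ℚ * p * - e) σy)))
    (trans (cong (λ u → b * (p - u) + ((2ℚ * (b * b) - 2ℚ * (p * b)) + 2ℚ * p * - - u)) (sym b≡))
      (trans (solve 2 (λ p b → b :* (p :- b) :+ ((con 2ℚ :* (b :* b) :- con 2ℚ :* (p :* b)) :+ con
            2ℚ :* p :* :- (:- b)) := b :* (p :+ b)) refl p b)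
        (cong₂ (λ u w → b * (u + w)) (sym (ℚ.0≤p⇒∣p∣≡p 0≤p)) b≡))))
    where
    ∣p-b∣ : ∣ p + σ * y ∣ ≡ p - ∣ y ∣
    ∣p-b∣ = trans (cong (λ e → ∣ p + e ∣) σy) (ℚ.0≤p⇒∣p∣≡p (0≤q-p y≤p))

  bound-true : ∀ x y x′ → Bound true 0ℚ x y x′
  bound-true x y x′ = ℚ.≤-reflexive (solve 2 (λ b σ → b :* con 0ℚ :+ (con 0ℚ :+ :- σ :* con 0ℚ) :=
        b :* con 0ℚ) refl b σ)

  bound-false : ∀ x y → ∣ x ∣ ≤ b → ∣ y ∣ ≤ b → Bound false 0ℚ x y x
  bound-false x y x≤b y≤b = subst₂ _≤_
    (solve 5 (λ b σ x y s → b :* s :- con 2ℚ :* (x :* (σ :* y)) := b :* s :+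
          (con 0ℚ :+ :- σ :* (x :* y :+ y :* x))) refl b σ x y ∣ x + σ * y ∣)
    (cong (λ e → b * (∣ x ∣ + e)) (∣sgn*p∣ c y))
    (b*∣x+y∣-2xy x (σ * y) x≤b (subst (_≤ b) (sym (∣sgn*p∣ c y)) y≤b))

  -- The maximality of `β` covers only non-zero frequencies, so the partner of `γ` has to be kept
  -- off the origin.
  ⊕β≢𝟘 : ∀ γ → ⟨ γ , v ⟩ ≡ false → γ ⊕ β ≢ 𝟘
  ⊕β≢𝟘 γ γv γβ≡𝟘 = contradiction
    (trans (sym (trans (cong ⟨_, v ⟩ γβ≡𝟘) ⟨𝟘, v ⟩)) (trans (⟨⟩-⊕ˡ γ β v) (cong₂ _xor_ γv βv))) λ ()

  bound-≢𝟘 : ∀ γ → γ ≢ 𝟘 → ∀ t → ⟨ γ , v ⟩ ≡ t → Bound t 0ℚ (a γ) (a (γ ⊕ β)) (a γ)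
  bound-≢𝟘 γ γ≢𝟘 true  _  = bound-true (a γ) (a (γ ⊕ β)) (a γ)
  bound-≢𝟘 γ γ≢𝟘 false γv = bound-false (a γ) (a (γ ⊕ β)) (max γ γ≢𝟘) (max (γ ⊕ β) (⊕β≢𝟘 γ γv))

  bound : ∀ γ → Bound ⟨ γ , v ⟩ (at𝟘 gain γ) (a γ) (a (γ ⊕ β)) (a γ)
  bound γ with γ ≟𝟘
  ... | no γ≢𝟘   = subst (λ z → Bound ⟨ γ , v ⟩ z (a γ) (a (γ ⊕ β)) (a γ)) (sym (at𝟘-≢ γ γ≢𝟘))
        (bound-≢𝟘 γ γ≢𝟘 ⟨ γ , v ⟩ refl)
  ... | yes refl = subst (λ t → Bound t (at𝟘 gain (𝟘 {n})) p (a (𝟘 ⊕ β)) p) (sym ⟨𝟘, v ⟩)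
    (subst (λ z → Bound false z p (a (𝟘 ⊕ β)) p) (sym (at𝟘-𝟘 n gain))
      (subst (λ δ → Bound false gain p (a δ) p) (sym (⊕-identityˡ β))
        (bound-𝟘 p (a β) (ℚ.≤-trans (ℚ.0≤∣p∣ (a β)) b≤p) b≤p σaβ refl)))

  pointwise : ∀ γ → left γ ≤ b * fold β v ∣a∣ γ
  pointwise γ = subst
    (λ x′ → b * ∣a′∣ γ + (at𝟘 gain γ + - σ * (if ⟨ γ , v ⟩ then 0ℚ else w γ + a (γ ⊕ β) * a x′)) ≤
          b * fold β v ∣a∣ γ)
    (sym (⊕-cancel γ β)) (bound γ)

opposite-sign : ∀ p → ∃[ c ] sgn c * p ≡ - ∣ p ∣
opposite-sign p with ℚ.∣p∣≡p∨∣p∣≡-p p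
... | inj₁ eq = true , trans (-1*p≡-p p) (cong -_ (sym eq))
... | inj₂ eq = false , trans (solve 1 (λ p → con 1ℚ :* p := :- (:- p)) refl p) (cong -_ (sym eq))

-- Subtracting the mean at the origin makes `h 𝟘` vanish, so a positive maximum of `h` lies at a
-- non-zero frequency. Were the maximum not positive, `variance-bound` with `b` = 0 would give p (1
-- - p) ≤ 0, against 0 < p ≤ ½.
largest : (f : Cube n → Bool) → 0ℚ < fourier f 𝟘 → fourier f 𝟘 ≤ ½ →
  ∃[ β ] (β ≢ 𝟘 × 0ℚ < ∣ fourier f β ∣ × (∀ γ → γ ≢ 𝟘 → ∣ fourier f γ ∣ ≤ ∣ fourier f β ∣))
largest {n} f 0<p p≤½ = β , β≢𝟘 , subst (0ℚ <_) (h-≢ β β≢𝟘) 0<hβ , λ γ γ≢𝟘 → subst₂ _≤_ (h-≢ γ γ≢𝟘)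
      (h-≢ β β≢𝟘) (max γ)
  where
  p : ℚ
  p = fourier f 𝟘

  h : Cube n → ℚ
  h γ = ∣ fourier f γ ∣ - at𝟘 p γ

  h-𝟘 : h 𝟘 ≡ 0ℚ
  h-𝟘 = trans (cong₂ _-_ (∣mean∣≡mean f) (at𝟘-𝟘 n p)) (ℚ.+-inverseʳ p)

  h-≢ : ∀ γ → γ ≢ 𝟘 → h γ ≡ ∣ fourier f γ ∣
  h-≢ γ γ≢𝟘 = trans (cong (λ z → ∣ fourier f γ ∣ - z) (at𝟘-≢ γ γ≢𝟘)) (ℚ.+-identityʳ ∣ fourier f γ ∣)

  β : Cube n
  β = proj₁ (argmax h)

  max : ∀ γ → h γ ≤ h β
  max = proj₂ (argmax h)

  0<p[1-p] : 0ℚ < p * (1ℚ - p)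
  0<p[1-p] = ℚ.<-≤-trans (ℚ.positive⁻¹ (p * ½) {{ℚ.pos*pos⇒pos p {{ℚ.positive 0<p}} ½}})
    (ℚ.*-monoˡ-≤-nonNeg p {{ℚ.nonNegative (0≤mean f)}} (p+r≡q⇒p≤q (½ - p) (0≤q-p p≤½)
      (solve 1 (λ p → con ½ :+ (con ½ :- p) := con 1ℚ :- p) refl p)))

  0<hβ : 0ℚ < h β
  0<hβ = ℚ.≰⇒> λ hβ≤0 → ℚ.<-irrefl refl (ℚ.<-≤-trans 0<p[1-p]
    (subst (p * (1ℚ - p) ≤_) (ℚ.*-zeroˡ (spectralNorm f - p))
      (variance-bound f 0ℚ λ γ γ≢𝟘 → subst (_≤ 0ℚ) (h-≢ γ γ≢𝟘) (ℚ.≤-trans (max γ) hβ≤0))))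

  β≢𝟘 : β ≢ 𝟘
  β≢𝟘 eq = ℚ.<-irrefl (sym (trans (cong h eq) h-𝟘)) 0<hβ

-- The new mean is p - b, so the bound ½ persists and the step can be iterated. As b ≤ p, the drop D
-- lies between 0 and 1, as `square-drop` requires.
norm-decrement-along : (f : Cube n → Bool) → 0ℚ < fourier f 𝟘 → fourier f 𝟘 ≤ ½ →
  (β v : Cube n) → ⟨ β , v ⟩ ≡ true → (c : Bool) →
  (∀ γ → γ ≢ 𝟘 → ∣ fourier f γ ∣ ≤ ∣ fourier f β ∣) → 0ℚ < ∣ fourier f β ∣ →
  sgn c * fourier f β ≡ - ∣ fourier f β ∣ →
  fourier (f ∘ move β v c) 𝟘 ≤ ½ ×
  spectralNorm (f ∘ move β v c) * spectralNorm (f ∘ move β v c) + 1ℚ ≤ spectralNorm f *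
        spectralNorm f
norm-decrement-along {n} f 0<p p≤½ β v βv c max 0<b σaβ = mean′≤½ ,
  ℚ.≤-trans (ℚ.+-monoˡ-≤ 1ℚ (≤⇒²≤² 0≤A′ A′≤A-D))
    (square-drop {A} {D} 0≤D D≤1 (drop-bound {p} {b} {A} p≤½ b≤p (variance-bound f b max)
          (1≤spectralNorm f 0<p)))
  where
  p b A A′ D : ℚ
  p = fourier f 𝟘
  b = ∣ fourier f β ∣
  A = spectralNorm f
  A′ = spectralNorm (f ∘ move β v c)
  D = 2ℚ * (½ - p) + 2ℚ * b

  b≤p : b ≤ p
  b≤p = ∣fourier∣≤mean f β

  0≤A′ : 0ℚ ≤ A′
  0≤A′ = ∑-nonNeg λ γ → ℚ.0≤∣p∣ (fourier (f ∘ move β v c) γ)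

  0≤D : 0ℚ ≤ D
  0≤D = 0≤+ (0≤* 0≤2 (0≤q-p p≤½)) (0≤* 0≤2 (ℚ.0≤∣p∣ (fourier f β)))

  D≤1 : D ≤ 1ℚ
  D≤1 = p+r≡q⇒p≤q (2ℚ * (p - b)) (0≤* 0≤2 (0≤q-p b≤p))
    (solve 2 (λ p b → con 2ℚ :* (con ½ :- p) :+ con 2ℚ :* b :+ con 2ℚ :* (p :- b) := con 1ℚ) refl p
          b)

  A′+D≤A : A′ + D ≤ A
  A′+D≤A = subst (λ S → S + D ≤ A) (∑-cong λ γ → cong ∣_∣ (sym (fourier-move β v βv c f γ)))
    (∑-restricted-drop (fourier f) β v βv c (fourier-convolution f β) max b≤p 0<b σaβ)

  A′≤A-D : A′ ≤ A - D
  A′≤A-D = subst (_≤ A - D) (solve 2 (λ A D → A :+ D :- D := A) refl A′ D)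
        (ℚ.+-monoˡ-≤ (- D) A′+D≤A)

  mean′≤½ : fourier (f ∘ move β v c) 𝟘 ≤ ½
  mean′≤½ = ℚ.≤-trans (ℚ.≤-reflexive mean′) (ℚ.≤-trans
    (p+r≡q⇒p≤q b (ℚ.0≤∣p∣ (fourier f β)) (solve 2 (λ p b → p :+ :- b :+ b := p) refl p b)) p≤½)
    where
    mean′ : fourier (f ∘ move β v c) 𝟘 ≡ p - b
    mean′ = trans (fourier-move β v βv c f 𝟘)
      (trans (cong (λ t → if t then 0ℚ else p + sgn c * fourier f (𝟘 ⊕ β)) ⟨𝟘, v ⟩)
        (cong (_+_ p) (trans (cong (λ δ → sgn c * fourier f δ) (⊕-identityˡ β)) σaβ)))

norm-decrement : (f : Cube n → Bool) → 0ℚ < fourier f 𝟘 → fourier f 𝟘 ≤ ½ →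
  ∃[ β ] ∃[ v ] ∃[ c ] (⟨ β , v ⟩ ≡ true × fourier (f ∘ move β v c) 𝟘 ≤ ½ ×
    spectralNorm (f ∘ move β v c) * spectralNorm (f ∘ move β v c) + 1ℚ ≤ spectralNorm f *
          spectralNorm f)
norm-decrement f 0<p p≤½ =
  let β , β≢𝟘 , 0<b , max = largest f 0<p p≤½
      v , βv = ⟨⟩-nondegenerate β β≢𝟘
      c , σaβ = opposite-sign (fourier f β)
  in β , v , c , βv , norm-decrement-along f 0<p p≤½ β v βv c max 0<b σaβ

-- Naturals among the rationals, and sequences of queries.

-- Built with `mkℚ` rather than `_/_` so that numerator and denominator reduce for a variable `m`.
ι : ℕ → ℚ
ι m = mkℚ (+ m) 0 (Coprime.sym (1-coprimeTo m))

ι-suc : ∀ m → ι (suc m) ≡ 1ℚ + ι m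
ι-suc m = sym (trans (ℚ./-cong (cong (λ i → + 1 ℤ.+ i) (ℤ.*-identityʳ (+ m))) refl)
      (ℚ.↥p/↧p≡p (ι (suc m))))

ι-double : ∀ m → ι (2 ℕ.* m) ≡ 2ℚ * ι m
ι-double m = sym (trans (ℚ./-cong (sym (ℤ.pos-* 2 m)) refl) (ℚ.↥p/↧p≡p (ι (2 ℕ.* m))))

ι-cancel-≤ : ∀ {k m} → ι k ≤ ι m → k ℕ.≤ m
ι-cancel-≤ {k} {m} (*≤* le) = ℤ.drop‿+≤+ (subst₂ ℤ._≤_ (ℤ.*-identityʳ (+ k)) (ℤ.*-identityʳ (+ m))
      le)

archimedean : ∀ q → ∃[ N ] q ≤ ι N
archimedean (mkℚ (+ m)    k _) = m , *≤* (ℤ.*-monoˡ-≤-nonNeg (+ m) (ℤ.+≤+ (ℕ.s≤s ℕ.z≤n)))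
archimedean (mkℚ -[1+ m ] k _) = 0 , *≤* ℤ.-≤+

-- `shift` witnesses that `direction` is non-zero and fixes the projection onto either half cube.
record Query (n : ℕ) : Set where
  constructor query
  field
    direction : Cube n
    shift     : Cube n
    dual      : ⟨ direction , shift ⟩ ≡ true

open Query

step : Query n → Bool → Cube n → Cube n
step q = move (direction q) (shift q)

-- f ∘ project qs cs is f restricted to the inputs that answer cs to qs.
project : (qs : List (Query n)) → Vec Bool (length qs) → Cube n → Cube n
project []       cs = id
project (q ∷ qs) cs = step q (head cs) ∘ project qs (tail cs)

spectralNorm-project : (qs : List (Query n)) (cs : Vec Bool (length qs)) (f : Cube n → Bool) →
  spectralNorm (f ∘ project qs cs) ≤ spectralNorm f
spectralNorm-project []       cs f = ℚ.≤-refl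
spectralNorm-project (q ∷ qs) cs f = ℚ.≤-trans
  (spectralNorm-project qs (tail cs) (f ∘ step q (head cs)))
  (spectralNorm-move (direction q) (shift q) (dual q) (head cs) f)

0≤spectralNorm : (f : Cube n → Bool) → 0ℚ ≤ spectralNorm f
0≤spectralNorm f = ∑-nonNeg λ γ → ℚ.0≤∣p∣ (fourier f γ)

-- `N` only bounds the recursion. Each restriction lowers the squared norm by at least 1, and the
-- number of queries is charged to the squared norm itself.
annihilate : ∀ N (f : Cube n → Bool) → fourier f 𝟘 ≤ ½ → spectralNorm f * spectralNorm f ≤ ι N →
  ∃[ qs ] ∃[ cs ] ((∀ x → f (project qs cs x) ≡ false) × ι (length qs) ≤ spectralNorm f *
        spectralNorm f)
annihilate N f p≤½ A²≤N = go N A²≤N (fourier f 𝟘 ℚ.≤? 0ℚ)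
  where
  go : ∀ N → spectralNorm f * spectralNorm f ≤ ι N → Dec (fourier f 𝟘 ≤ 0ℚ) →
    ∃[ qs ] ∃[ cs ] ((∀ x → f (project qs cs x) ≡ false) × ι (length qs) ≤ spectralNorm f *
          spectralNorm f)
  go _ _ (yes p≤0) = [] , [] , mean≤0⇒false f p≤0 , 0≤* (0≤spectralNorm f) (0≤spectralNorm f)
  -- A further decrement from a squared norm at most 0 would give 1 ≤ 0.
  go zero A²≤0 (no p≰0) =
    let β , v , c , βv , p′≤½ , decrement = norm-decrement f (ℚ.≰⇒> p≰0) p≤½
        0≤A′² = 0≤* (0≤spectralNorm (f ∘ move β v c)) (0≤spectralNorm (f ∘ move β v c))
    in contradiction (ℚ.≤-trans (ℚ.+-monoˡ-≤ 1ℚ 0≤A′²) (ℚ.≤-trans decrement A²≤0)) λ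
          { (*≤* (ℤ.+≤+ ())) }
  go (suc N) A²≤1+N (no p≰0) =
    let β , v , c , βv , p′≤½ , decrement = norm-decrement f (ℚ.≰⇒> p≰0) p≤½
        f′ = f ∘ move β v c
        A′² = spectralNorm f′ * spectralNorm f′
        A′²≤N = subst₂ _≤_ (minus-1 A′²) (trans (cong (_- 1ℚ)
              (trans (ι-suc N) (ℚ.+-comm 1ℚ (ι N)))) (minus-1 (ι N)))
                  (ℚ.+-monoˡ-≤ (- 1ℚ) (ℚ.≤-trans decrement A²≤1+N))
        qs , cs , zero′ , len = annihilate N f′ p′≤½ A′²≤N
    in query β v βv ∷ qs , c ∷ cs , zero′ ,
       ℚ.≤-trans (ℚ.≤-reflexive (trans (ι-suc (length qs)) (ℚ.+-comm 1ℚ (ι (length qs)))))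
         (ℚ.≤-trans (ℚ.+-monoˡ-≤ 1ℚ len) decrement)
    where
    minus-1 : ∀ q → q + 1ℚ - 1ℚ ≡ q
    minus-1 = solve 1 (λ q → q :+ con 1ℚ :- con 1ℚ := q) refl

-- Merging of frequencies under restriction.

-- a lists the values at one frequency of the transforms of a family of restrictions of f, and m
-- counts the points of the support of f that have been merged into that frequency.
data Multiplicity {I : Set} (a : I → ℚ) (m : ℚ) : Set where
  none   : m ≡ 0ℚ → (∀ i → a i ≡ 0ℚ) → Multiplicity a m
  single : m ≡ 1ℚ → ∀ u → 0ℚ < u → u < 1ℚ → (∀ i → ∣ a i ∣ ≡ u) → Multiplicity a m
  many   : 2ℚ ≤ m → Multiplicity a m

Multiplicity-cong : {I : Set} {a b : I → ℚ} {m : ℚ} → (∀ i → a i ≡ b i) → Multiplicity a m →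
      Multiplicity b m
Multiplicity-cong eq (none m≡0 a≡0)              = none m≡0 λ i → trans (sym (eq i)) (a≡0 i)
Multiplicity-cong eq (single m≡1 u 0<u u<1 ∣a∣≡u) = single m≡1 u 0<u u<1 λ i → trans
      (cong ∣_∣ (sym (eq i))) (∣a∣≡u i)
Multiplicity-cong eq (many 2≤m)                  = many 2≤m

Multiplicity-reindex : {I J : Set} {a : I → ℚ} {m : ℚ} (k : J → I) → Multiplicity a m →
      Multiplicity (a ∘ k) m
Multiplicity-reindex k (none m≡0 a≡0)              = none m≡0 (a≡0 ∘ k)
Multiplicity-reindex k (single m≡1 u 0<u u<1 ∣a∣≡u) = single m≡1 u 0<u u<1 (∣a∣≡u ∘ k)
Multiplicity-reindex k (many 2≤m)                  = many 2≤m

Multiplicity-nonNeg : {I : Set} {a : I → ℚ} {m : ℚ} → Multiplicity a m → 0ℚ ≤ m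
Multiplicity-nonNeg (none m≡0 _)         = ℚ.≤-reflexive (sym m≡0)
Multiplicity-nonNeg (single m≡1 _ _ _ _) = ℚ.≤-trans 0≤1 (ℚ.≤-reflexive (sym m≡1))
Multiplicity-nonNeg (many 2≤m)           = ℚ.≤-trans 0≤2 2≤m

-- Merging with an empty fibre changes a coefficient at most by a sign, so a singleton keeps its
-- absolute value. Two singletons may cancel for some answers, so only their count is kept.
Multiplicity-+ : {I : Set} {a b : I → ℚ} {k m : ℚ} → Multiplicity a k → Multiplicity b m →
  Multiplicity {I × Bool} (λ (i , c) → a i + sgn c * b i) (k + m)
Multiplicity-+ (none k≡0 a≡0) (none m≡0 b≡0) = none (cong₂ _+_ k≡0 m≡0) λ (i , c) →
  trans (cong₂ (λ x y → x + sgn c * y) (a≡0 i) (b≡0 i))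
        (trans (ℚ.+-identityˡ _) (ℚ.*-zeroʳ (sgn c)))
Multiplicity-+ {b = b} (none k≡0 a≡0) (single m≡1 u 0<u u<1 ∣b∣≡u) = single (cong₂ _+_ k≡0 m≡1) u
      0<u u<1 λ (i , c) →
  trans (cong ∣_∣ (trans (cong (_+ sgn c * b i) (a≡0 i)) (ℚ.+-identityˡ _)))
        (trans (∣sgn*p∣ c (b i)) (∣b∣≡u i))
Multiplicity-+ {a = a} (single k≡1 u 0<u u<1 ∣a∣≡u) (none m≡0 b≡0) = single (cong₂ _+_ k≡1 m≡0) u
      0<u u<1 λ (i , c) →
  trans (cong ∣_∣ (trans (cong (λ y → a i + sgn c * y) (b≡0 i))
        (trans (cong (_+_ (a i)) (ℚ.*-zeroʳ (sgn c))) (ℚ.+-identityʳ _)))) (∣a∣≡u i)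
Multiplicity-+ (single k≡1 _ _ _ _) (single m≡1 _ _ _ _) = many
      (ℚ.≤-reflexive (sym (cong₂ _+_ k≡1 m≡1)))
Multiplicity-+ {k = k} {m} (many 2≤k) M = many (ℚ.≤-trans 2≤k
      (p+r≡q⇒p≤q m (Multiplicity-nonNeg M) refl))
Multiplicity-+ {k = k} {m} M@(none _ _) (many 2≤m) = many
      (ℚ.≤-trans 2≤m (p+r≡q⇒p≤q k (Multiplicity-nonNeg M) (ℚ.+-comm m k)))
Multiplicity-+ {k = k} {m} M@(single _ _ _ _ _) (many 2≤m) = many
      (ℚ.≤-trans 2≤m (p+r≡q⇒p≤q k (Multiplicity-nonNeg M) (ℚ.+-comm m k)))

Multiplicities : {I : Set} → (I → Cube n → Bool) → (Cube n → ℚ) → Set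
Multiplicities F m = ∀ γ → Multiplicity (λ i → fourier (F i) γ) (m γ)

Multiplicities-step : {I : Set} (F : I → Cube n → Bool) {m : Cube n → ℚ} (q : Query n) →
      Multiplicities F m →
  Multiplicities {I = I × Bool} (λ (i , c) → F i ∘ step q c) (fold (direction q) (shift q) m)
Multiplicities-step {I = I} F {m} (query β v βv) M γ =
  Multiplicity-cong (λ (i , c) → sym (fourier-move β v βv c (F i) γ)) (go ⟨ γ , v ⟩)
  where
  go : ∀ t → Multiplicity {I × Bool} (λ (i , c) → if t then 0ℚ else fourier (F i) γ + sgn c *
        fourier (F i) (γ ⊕ β))
                          (if t then 0ℚ else m γ + m (γ ⊕ β))
  go true  = none refl λ _ → refl
  go false = Multiplicity-+ (M γ) (M (γ ⊕ β))

-- One count serves all answers at once, since the answers affect only signs; the index type gains a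
-- factor `Bool` per query. Folding keeps the total, and the origin, being orthogonal to every
-- `shift`, never loses weight.
Multiplicities-project : (qs : List (Query n)) {I : Set} (F : I → Cube n → Bool) (m : Cube n → ℚ) →
  Multiplicities F m → 1ℚ ≤ m 𝟘 →
  ∃[ m′ ] (Multiplicities {I = I × Vec Bool (length qs)} (λ (i , cs) → F i ∘ project qs cs) m′ × ∑
        m′ ≡ ∑ m × 1ℚ ≤ m′ 𝟘)
Multiplicities-project []       F m M 1≤m = m , (λ γ → Multiplicity-reindex proj₁ (M γ)) , refl ,
      1≤m
Multiplicities-project (q@(query β v βv) ∷ qs) F m M 1≤m =
  let m′ , M′ , ∑≡ , 1≤m′ = Multiplicities-project qs (λ (i , c) → F i ∘ step q c) (fold β v m)
        (Multiplicities-step F q M)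
        (subst (λ t → 1ℚ ≤ (if t then 0ℚ else m 𝟘 + m (𝟘 ⊕ β))) (sym ⟨𝟘, v ⟩)
          (ℚ.≤-trans 1≤m (p+r≡q⇒p≤q (m (𝟘 ⊕ β)) (Multiplicity-nonNeg (M (𝟘 ⊕ β))) refl)))
  in m′ , (λ γ → Multiplicity-reindex (λ (i , cs) → (i , head cs) , tail cs) (M′ γ)) , trans ∑≡
        (∑-fold β v βv m) , 1≤m′

-- Restriction to constancy and halving of the sparsity.

indicator : {P : Set} → Dec P → ℚ
indicator P? = if does P? then 1ℚ else 0ℚ

support : (Cube n → Bool) → Cube n → ℚ
support f γ = indicator (¬? (fourier f γ ℚ.≟ 0ℚ))

∑-support : (f : Cube n → Bool) → ∑ (support f) ≡ ι (sparsity f)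
∑-support {n} f = go (cube n)
  where
  go : ∀ γs → List.foldr _+_ 0ℚ (List.map (support f) γs) ≡ ι
        (length (filter (λ γ → ¬? (fourier f γ ℚ.≟ 0ℚ)) γs))
  go []       = refl
  go (γ ∷ γs) with does (fourier f γ ℚ.≟ 0ℚ)
  ... | true  = trans (ℚ.+-identityˡ _) (go γs)
  ... | false = trans (cong (_+_ 1ℚ) (go γs)) (sym (ι-suc _))

at𝟘≤∑ : (g : Cube n → ℚ) → (∀ γ → 0ℚ ≤ g γ) → g 𝟘 ≤ ∑ g
at𝟘≤∑ {n} g 0≤g = subst (_≤ ∑ g) (∑-at𝟘 n (g 𝟘)) (∑-mono pointwise)
  where
  pointwise : ∀ γ → at𝟘 (g 𝟘) γ ≤ g γ
  pointwise γ with γ ≟𝟘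
  ... | yes refl = ℚ.≤-reflexive (at𝟘-𝟘 n (g 𝟘))
  ... | no γ≢𝟘   = ℚ.≤-trans (ℚ.≤-reflexive (at𝟘-≢ γ γ≢𝟘)) (0≤g γ)

mean-not : (f : Cube n → Bool) → fourier (not ∘ f) 𝟘 ≡ 1ℚ - fourier f 𝟘
mean-not {n} f = trans (fourier-not f 𝟘) (cong (_- fourier f 𝟘) (at𝟘-𝟘 n 1ℚ))

1≤mean⇒true : (f : Cube n → Bool) → 1ℚ ≤ fourier f 𝟘 → ∀ x → f x ≡ true
1≤mean⇒true f 1≤p x = trans (sym (not-involutive (f x))) (cong not (mean≤0⇒false (not ∘ f)
  (subst₂ _≤_ (sym (mean-not f)) (ℚ.+-inverseʳ (fourier f 𝟘)) (ℚ.+-monoˡ-≤ (- fourier f 𝟘) 1≤p)) x))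

-- Complementing negates every coefficient away from the origin and replaces p by 1 - p, which is at
-- most p here.
spectralNorm-not : (f : Cube n → Bool) → ½ ≤ fourier f 𝟘 → spectralNorm (not ∘ f) ≤ spectralNorm f
spectralNorm-not {n} f ½≤p = ∑-mono λ γ → subst (λ e → ∣ e ∣ ≤ ∣ fourier f γ ∣)
      (sym (fourier-not f γ)) (bound γ (γ ≟𝟘))
  where
  p : ℚ
  p = fourier f 𝟘

  1-p≤p : 1ℚ - p ≤ p
  1-p≤p = p+r≡q⇒p≤q (2ℚ * (p - ½)) (0≤* 0≤2 (0≤q-p ½≤p))
    (solve 1 (λ p → con 1ℚ :- p :+ con 2ℚ :* (p :- con ½) := p) refl p)

  0≤1-p : 0ℚ ≤ 1ℚ - p
  0≤1-p = subst (0ℚ ≤_) (mean-not f) (0≤mean (not ∘ f))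

  bound : ∀ γ → Dec (γ ≡ 𝟘) → ∣ at𝟘 1ℚ γ - fourier f γ ∣ ≤ ∣ fourier f γ ∣
  bound γ (no γ≢𝟘) = ℚ.≤-reflexive (trans (cong (λ z → ∣ z - fourier f γ ∣) (at𝟘-≢ γ γ≢𝟘))
    (trans (cong ∣_∣ (ℚ.+-identityˡ (- fourier f γ))) (ℚ.∣-p∣≡∣p∣ (fourier f γ))))
  bound γ (yes γ≡𝟘) = subst (λ δ → ∣ at𝟘 1ℚ δ - fourier f δ ∣ ≤ ∣ fourier f δ ∣) (sym γ≡𝟘)
    (subst₂ _≤_ (sym (trans (cong (λ z → ∣ z - p ∣) (at𝟘-𝟘 n 1ℚ)) (ℚ.0≤p⇒∣p∣≡p 0≤1-p)))
          (sym (∣mean∣≡mean f)) 1-p≤p)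

-- A mean above ½ is handled through the complement, whose mean is at most ½ and whose norm is no
-- larger.
make-constant : (f : Cube n → Bool) →
  ∃[ qs ] ∃[ cs ] ∃[ b ] ((∀ x → f (project qs cs x) ≡ b) × ι (length qs) ≤ spectralNorm f *
        spectralNorm f)
make-constant f = go (ℚ.≤-total (fourier f 𝟘) ½)
  where
  go : fourier f 𝟘 ≤ ½ ⊎ ½ ≤ fourier f 𝟘 →
    ∃[ qs ] ∃[ cs ] ∃[ b ] ((∀ x → f (project qs cs x) ≡ b) × ι (length qs) ≤ spectralNorm f *
          spectralNorm f)
  go (inj₁ p≤½) =
    let N , A²≤N = archimedean (spectralNorm f * spectralNorm f)
        qs , cs , constant , len = annihilate N f p≤½ A²≤N
    in qs , cs , false , constant , len
  go (inj₂ ½≤p) =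
    let h = not ∘ f
        N , A²≤N = archimedean (spectralNorm h * spectralNorm h)
        1-p≤½ = subst (_≤ ½) (sym (mean-not f)) (ℚ.+-monoʳ-≤ 1ℚ (ℚ.neg-antimono-≤ ½≤p))
        qs , cs , constant , len = annihilate N h 1-p≤½ A²≤N
    in qs , cs , true , (λ x → trans (sym (not-involutive _)) (cong not (constant x))) ,
       ℚ.≤-trans len (≤⇒²≤² (0≤spectralNorm h) (spectralNorm-not f ½≤p))

fourier-constant : (g : Cube n → Bool) (b : Bool) → (∀ x → g x ≡ b) →
  ∀ γ → ∣ fourier g γ ∣ ≡ 0ℚ ⊎ ∣ fourier g γ ∣ ≡ 1ℚ
fourier-constant g false g≡ γ = inj₁ (cong ∣_∣ (trans
      (𝔼-cong λ x → cong (λ b → ⟦ b ⟧ * χ γ x) (g≡ x))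
  (trans (𝔼-* 0ℚ (χ γ)) (ℚ.*-zeroˡ (𝔼 (χ γ))))))
fourier-constant {n} g true g≡ γ = go (γ ≟𝟘)
  where
  coefficient : ∀ γ → fourier g γ ≡ at𝟘 1ℚ γ
  coefficient γ = trans (𝔼-cong λ x → cong (λ b → ⟦ b ⟧ * χ γ x) (g≡ x)) (transform-one γ)

  go : Dec (γ ≡ 𝟘) → ∣ fourier g γ ∣ ≡ 0ℚ ⊎ ∣ fourier g γ ∣ ≡ 1ℚ
  go (yes γ≡𝟘) = inj₂ (cong ∣_∣ (trans (coefficient γ) (trans (cong (at𝟘 1ℚ) γ≡𝟘) (at𝟘-𝟘 n 1ℚ))))
  go (no γ≢𝟘)  = inj₁ (cong ∣_∣ (trans (coefficient γ) (at𝟘-≢ γ γ≢𝟘)))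

-- Before any restriction each fibre is a single frequency; its coefficient stays below 1 because
-- the mean bounds it.
support-Multiplicities : (f : Cube n → Bool) → fourier f 𝟘 < 1ℚ → Multiplicities {I = ⊤} (λ _ → f)
      (support f)
support-Multiplicities f p<1 γ = go (fourier f γ ℚ.≟ 0ℚ)
  where
  go : (d : Dec (fourier f γ ≡ 0ℚ)) → Multiplicity {I = ⊤} (λ _ → fourier f γ) (indicator (¬? d))
  go (yes a≡0) = none refl λ _ → a≡0
  go (no a≢0)  = single refl ∣ fourier f γ ∣
    (ℚ.≰⇒> λ ∣a∣≤0 → a≢0 (ℚ.∣p∣≡0⇒p≡0 (fourier f γ) (ℚ.≤-antisym ∣a∣≤0 (ℚ.0≤∣p∣ (fourier f γ)))))
    (ℚ.≤-<-trans (∣fourier∣≤mean f γ) p<1) λ _ → refl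

1≤support-𝟘 : (f : Cube n → Bool) → 0ℚ < fourier f 𝟘 → 1ℚ ≤ support f 𝟘
1≤support-𝟘 f 0<p = go (fourier f 𝟘 ℚ.≟ 0ℚ)
  where
  go : (d : Dec (fourier f 𝟘 ≡ 0ℚ)) → 1ℚ ≤ indicator (¬? d)
  go (yes p≡0) = contradiction 0<p (ℚ.<-irrefl (sym p≡0))
  go (no _)    = ℚ.≤-refl

double-support≤ : (g : Cube n → Bool) (γ : Cube n) {m : ℚ} →
  (m ≡ 0ℚ × fourier g γ ≡ 0ℚ) ⊎ 2ℚ ≤ m → 2ℚ * support g γ ≤ m
double-support≤ g γ {m} = go (fourier g γ ℚ.≟ 0ℚ)
  where
  go : (d : Dec (fourier g γ ≡ 0ℚ)) → (m ≡ 0ℚ × fourier g γ ≡ 0ℚ) ⊎ 2ℚ ≤ m → 2ℚ * indicator (¬? d)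
        ≤ m
  go (yes _)  (inj₁ (m≡0 , _)) = ℚ.≤-reflexive (sym m≡0)
  go (yes _)  (inj₂ 2≤m)       = ℚ.≤-trans 0≤2 2≤m
  go (no a≢0) (inj₁ (_ , a≡0)) = contradiction a≡0 a≢0
  go (no _)   (inj₂ 2≤m)       = 2≤m

-- A singleton fibre would yield a coefficient of absolute value strictly between 0 and 1 for
-- all answers, but a constant function has no such coefficient.
sparsity-halves : (f : Cube n → Bool) → 0ℚ < fourier f 𝟘 → fourier f 𝟘 < 1ℚ →
  (qs : List (Query n)) (cs₀ : Vec Bool (length qs)) (b : Bool) → (∀ x → f (project qs cs₀ x) ≡ b) →
  2 ℕ.≤ sparsity f × (∀ cs → 2 ℕ.* sparsity (f ∘ project qs cs) ℕ.≤ sparsity f)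
sparsity-halves {n} f 0<p p<1 qs cs₀ b constant = go
  (Multiplicities-project qs (λ (_ : ⊤) → f) (support f) (support-Multiplicities f p<1)
        (1≤support-𝟘 f 0<p))
  where
  go : ∃[ m ] (Multiplicities {I = ⊤ × Vec Bool (length qs)} (λ (_ , cs) → f ∘ project qs cs) m ×
               ∑ m ≡ ∑ (support f) × 1ℚ ≤ m 𝟘) →
       2 ℕ.≤ sparsity f × (∀ cs → 2 ℕ.* sparsity (f ∘ project qs cs) ℕ.≤ sparsity f)
  go (m , M , ∑m , 1≤m𝟘) =
    ι-cancel-≤ (subst (2ℚ ≤_) ∑m≡ (ℚ.≤-trans (2≤m𝟘 (M 𝟘))
          (at𝟘≤∑ m (λ γ → Multiplicity-nonNeg (M γ))))) ,
    λ cs → ι-cancel-≤ (subst₂ _≤_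
      (trans (∑-* 2ℚ (support (f ∘ project qs cs)))
            (trans (cong (2ℚ *_) (∑-support (f ∘ project qs cs)))
        (sym (ι-double (sparsity (f ∘ project qs cs))))))
      ∑m≡ (∑-mono λ γ → double-support≤ (f ∘ project qs cs) γ (no-singleton γ cs (M γ))))
    where
    ∑m≡ : ∑ m ≡ ι (sparsity f)
    ∑m≡ = trans ∑m (∑-support f)

    no-singleton : ∀ γ cs {k} → Multiplicity (λ (_ , cs) → fourier (f ∘ project qs cs) γ) k →
      (k ≡ 0ℚ × fourier (f ∘ project qs cs) γ ≡ 0ℚ) ⊎ 2ℚ ≤ k
    no-singleton γ cs (none k≡0 a≡0) = inj₁ (k≡0 , a≡0 (tt , cs))
    no-singleton γ cs (many 2≤k)     = inj₂ 2≤k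
    no-singleton γ cs (single _ u 0<u u<1 ∣a∣≡u) = absurd
          (fourier-constant (f ∘ project qs cs₀) b constant γ)
      where
      absurd : ∀ {X : Set} → ∣ fourier (f ∘ project qs cs₀) γ ∣ ≡ 0ℚ ⊎ ∣ fourier
            (f ∘ project qs cs₀) γ ∣ ≡ 1ℚ → X
      absurd (inj₁ ∣a∣≡0) = contradiction 0<u (ℚ.<-irrefl (trans (sym ∣a∣≡0) (∣a∣≡u (tt , cs₀))))
      absurd (inj₂ ∣a∣≡1) = contradiction u<1 (ℚ.<-irrefl (trans (sym (∣a∣≡u (tt , cs₀))) ∣a∣≡1))

    -- The fibre over the origin is non-empty by `1≤m𝟘`, so without singletons it has at least two
    -- support points; hence the sparsity is at least 2.
    2≤m𝟘 : Multiplicity (λ (_ , cs) → fourier (f ∘ project qs cs) 𝟘) (m 𝟘) → 2ℚ ≤ m 𝟘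
    2≤m𝟘 M𝟘 with no-singleton 𝟘 cs₀ M𝟘
    ... | inj₂ 2≤m       = 2≤m
    ... | inj₁ (m≡0 , _) = contradiction (subst (1ℚ ≤_) m≡0 1≤m𝟘) λ { (*≤* (ℤ.+≤+ ())) }

-- Assembling the tree and bounding its depth.

-- `step q c` fixes the inputs that answer `c` to `q`, so each subtree meets only inputs on which
-- the restriction agrees with `f`.
node-computes : (f : Cube n → Bool) (q : Query n) {T₀ T₁ : ParityDT n} →
  T₀ Computes (f ∘ step q false) → T₁ Computes (f ∘ step q true) → node (direction q) T₀ T₁
        Computes f
node-computes f q {T₀} {T₁} ok₀ ok₁ x with ⟨ direction q , x ⟩ | ok₀ x | ok₁ x
... | false | eval₀ | _     = eval₀
... | true  | _     | eval₁ = eval₁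

-- The queries are the same on every branch, so they form a complete tree whose leaves are replaced
-- by the trees for their answers. Each level multiplies the exponentiated depth by 2 ^ K.
assemble : (qs : List (Query n)) (f : Cube n → Bool) (K X : ℕ) →
  (∀ cs → ∃[ T ] (T Computes (f ∘ project qs cs) × 2 ℕ.^ (depth T ℕ.* K) ℕ.≤ X)) →
  ∃[ T ] (T Computes f × 2 ℕ.^ (depth T ℕ.* K) ℕ.≤ 2 ℕ.^ (length qs ℕ.* K) ℕ.* X)
assemble []       f K X trees =
  let T , ok , bound = trees []
  in T , ok , ℕ.≤-trans bound (ℕ.≤-reflexive (sym (ℕ.*-identityˡ X)))
assemble (q ∷ qs) f K X trees =
  let T₀ , ok₀ , bound₀ = assemble qs (f ∘ step q false) K X (λ cs → trees (false ∷ cs))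
      T₁ , ok₁ , bound₁ = assemble qs (f ∘ step q true) K X (λ cs → trees (true ∷ cs))
  in node (direction q) T₀ T₁ , node-computes f q {T₀} {T₁} ok₀ ok₁ ,
     (begin
       2 ℕ.^ (suc (depth T₀ ℕ.⊔ depth T₁) ℕ.* K)               ≡⟨ ℕ.^-distribˡ-+-* 2 K _ ⟩
       2 ℕ.^ K ℕ.* 2 ℕ.^ ((depth T₀ ℕ.⊔ depth T₁) ℕ.* K)       ≤⟨ ℕ.*-monoʳ-≤ (2 ℕ.^ K)
             (deeper (depth T₀) (depth T₁) bound₀ bound₁) ⟩
       2 ℕ.^ K ℕ.* (2 ℕ.^ (length qs ℕ.* K) ℕ.* X)             ≡⟨ ℕ.*-assoc (2 ℕ.^ K) _ X ⟨
       2 ℕ.^ K ℕ.* 2 ℕ.^ (length qs ℕ.* K) ℕ.* X               ≡⟨ cong (ℕ._* X)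
             (ℕ.^-distribˡ-+-* 2 K _) ⟨
       2 ℕ.^ (suc (length qs) ℕ.* K) ℕ.* X                     ∎)
  where
  open ℕ.≤-Reasoning

  deeper : ∀ d e {Y} → 2 ℕ.^ (d ℕ.* K) ℕ.≤ Y → 2 ℕ.^ (e ℕ.* K) ℕ.≤ Y → 2 ℕ.^ ((d ℕ.⊔ e) ℕ.* K) ℕ.≤ Y
  deeper d e le le′ with ℕ.⊔-sel d e
  ... | inj₁ eq = subst (λ m → 2 ℕ.^ (m ℕ.* K) ℕ.≤ _) (sym eq) le
  ... | inj₂ eq = subst (λ m → 2 ℕ.^ (m ℕ.* K) ℕ.≤ _) (sym eq) le′

[m*n]^e≡m^e*n^e : ∀ m n e → (m ℕ.* n) ℕ.^ e ≡ m ℕ.^ e ℕ.* n ℕ.^ e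
[m*n]^e≡m^e*n^e m n zero    = refl
[m*n]^e≡m^e*n^e m n (suc e) = trans (cong (m ℕ.* n ℕ.*_) ([m*n]^e≡m^e*n^e m n e))
  (ℕ.[m*n]*[o*p]≡[m*o]*[n*p] m n (m ℕ.^ e) (n ℕ.^ e))

2*⌊m/2⌋≤m : ∀ m → 2 ℕ.* ⌊ m /2⌋ ℕ.≤ m
2*⌊m/2⌋≤m m = begin
  2 ℕ.* ⌊ m /2⌋            ≡⟨ cong (⌊ m /2⌋ ℕ.+_) (ℕ.+-identityʳ ⌊ m /2⌋) ⟩
  ⌊ m /2⌋ ℕ.+ ⌊ m /2⌋      ≤⟨ ℕ.+-monoʳ-≤ ⌊ m /2⌋ (ℕ.⌊n/2⌋≤⌈n/2⌉ m) ⟩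
  ⌊ m /2⌋ ℕ.+ ℕ.⌈ m /2⌉    ≡⟨ ℕ.⌊n/2⌋+⌈n/2⌉≡n m ⟩
  m                        ∎
  where open ℕ.≤-Reasoning

2*k≤m⇒k≤⌊m/2⌋ : ∀ {k m} → 2 ℕ.* k ℕ.≤ m → k ℕ.≤ ⌊ m /2⌋
2*k≤m⇒k≤⌊m/2⌋ {k} {m} le = subst (ℕ._≤ ⌊ m /2⌋) (sym (ℕ.n≡⌊n+n/2⌋ k))
  (ℕ.⌊n/2⌋-mono (subst (ℕ._≤ m) (cong (k ℕ.+_) (ℕ.+-identityʳ k)) le))

-- The fraction P / K stands in for `Q`, which stays fixed because restriction never raises the
-- norm. A round of queries costs a factor of at most 2 ^ P and halves the sparsity bound, and 2 ^ P
-- · (s/2) ^ P ≤ s ^ P. `fuel` makes the recursion structural.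
parity-tree : (Q : ℚ) (P K : ℕ) → (∀ {m} → ι m ≤ Q → m ℕ.* K ℕ.≤ P) →
  (fuel s : ℕ) → s ℕ.≤ fuel → 1 ℕ.≤ s → (f : Cube n → Bool) →
  spectralNorm f * spectralNorm f ≤ Q → sparsity f ℕ.≤ s →
  ∃[ T ] (T Computes f × 2 ℕ.^ (depth T ℕ.* K) ℕ.≤ s ℕ.^ P)
parity-tree Q P K Q≤P/K zero    _ ℕ.z≤n ()
parity-tree Q P K Q≤P/K (suc fuel) s s≤fuel 1≤s f A²≤Q sparse =
  go (fourier f 𝟘 ℚ.≤? 0ℚ) (1ℚ ℚ.≤? fourier f 𝟘)
  where
  open ℕ.≤-Reasoning

  s/2 : ℕ
  s/2 = ⌊ s /2⌋

  Tree : Set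
  Tree = ∃[ T ] (T Computes f × 2 ℕ.^ (depth T ℕ.* K) ℕ.≤ s ℕ.^ P)

  trivial : 1 ℕ.≤ s ℕ.^ P
  trivial = ℕ.m^n>0 s {{ℕ.>-nonZero 1≤s}} P

  go : Dec (fourier f 𝟘 ≤ 0ℚ) → Dec (1ℚ ≤ fourier f 𝟘) → Tree
  go (yes p≤0) _         = leaf false , (λ x → sym (mean≤0⇒false f p≤0 x)) , trivial
  go (no _)    (yes 1≤p) = leaf true , (λ x → sym (1≤mean⇒true f 1≤p x)) , trivial
  go (no p≰0)  (no 1≰p)  =
    let qs , cs₀ , b , constant , len = make-constant f
        2≤sparsity , halves = sparsity-halves f (ℚ.≰⇒> p≰0) (ℚ.≰⇒> 1≰p) qs cs₀ b constant
        1≤s/2 = ℕ.⌊n/2⌋-mono (ℕ.≤-trans 2≤sparsity sparse)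
        -- From 1 ≤ s/2 follows 1 + s/2 ≤ 2 · s/2 ≤ s ≤ 1 + fuel.
        s/2≤fuel = ℕ.s≤s⁻¹ (ℕ.≤-trans (ℕ.+-mono-≤ 1≤s/2 (ℕ.m≤m+n s/2 0))
              (ℕ.≤-trans (2*⌊m/2⌋≤m s) s≤fuel))
        T , ok , bound = assemble qs f K (s/2 ℕ.^ P) λ cs →
          parity-tree Q P K Q≤P/K fuel s/2 s/2≤fuel 1≤s/2 (f ∘ project qs cs)
            (ℚ.≤-trans (≤⇒²≤² (0≤spectralNorm (f ∘ project qs cs)) (spectralNorm-project qs cs f))
                  A²≤Q)
            (2*k≤m⇒k≤⌊m/2⌋ (ℕ.≤-trans (halves cs) sparse))
    in T , ok , (begin
      2 ℕ.^ (depth T ℕ.* K)                        ≤⟨ bound ⟩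
      2 ℕ.^ (length qs ℕ.* K) ℕ.* s/2 ℕ.^ P        ≤⟨ ℕ.*-monoˡ-≤ (s/2 ℕ.^ P)
            (ℕ.^-monoʳ-≤ 2 (Q≤P/K (ℚ.≤-trans len A²≤Q))) ⟩
      2 ℕ.^ P ℕ.* s/2 ℕ.^ P                        ≡⟨ [m*n]^e≡m^e*n^e 2 s/2 P ⟨
      (2 ℕ.* s/2) ℕ.^ P                            ≤⟨ ℕ.^-monoˡ-≤ P (2*⌊m/2⌋≤m s) ⟩
      s ℕ.^ P                                      ∎)

-- `Q` is a variable so that matching on `mkℚ` unfolds the logarithmic bound. The zero function is
-- separated because its sparsity is 0, while `parity-tree` asks for a positive bound.
parity-tree-log : (f : Cube n → Bool) (Q : ℚ) → spectralNorm f * spectralNorm f ≡ Q →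
  ∃[ T ] (T Computes f × depth T ≤ Q ·log₂ sparsity f)
parity-tree-log f (mkℚ -[1+ P ] k _) A²≡Q =
  contradiction (subst (0ℚ ≤_) A²≡Q (0≤* (0≤spectralNorm f) (0≤spectralNorm f))) λ { (*≤* ()) }
parity-tree-log {n} f Q@(mkℚ (+ P) k _) A²≡Q = go (fourier f 𝟘 ℚ.≤? 0ℚ)
  where
  go : Dec (fourier f 𝟘 ≤ 0ℚ) → ∃[ T ] (T Computes f × depth T ≤ Q ·log₂ sparsity f)
  go (no p≰0) = parity-tree Q P (suc k) numerators (sparsity f) (sparsity f) ℕ.≤-refl 1≤sparsity f
        (ℚ.≤-reflexive A²≡Q) ℕ.≤-refl
    where
    numerators : ∀ {m} → ι m ≤ Q → m ℕ.* suc k ℕ.≤ P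
    numerators {m} (*≤* le) = ℤ.drop‿+≤+ (subst₂ ℤ._≤_ (sym (ℤ.pos-* m (suc k)))
          (ℤ.*-identityʳ (+ P)) le)

    0≤support : ∀ γ → 0ℚ ≤ support f γ
    0≤support γ with does (fourier f γ ℚ.≟ 0ℚ)
    ... | true  = ℚ.≤-refl
    ... | false = 0≤1

    1≤sparsity : 1 ℕ.≤ sparsity f
    1≤sparsity = ι-cancel-≤ (subst (1ℚ ≤_) (∑-support f)
      (ℚ.≤-trans (1≤support-𝟘 f (ℚ.≰⇒> p≰0)) (at𝟘≤∑ (support f) 0≤support)))
  -- The norm vanishes, so P = 0 and the bound for a leaf reads 1 ≤ s ^ 0.
  go (yes p≤0) = leaf false , (λ x → sym (mean≤0⇒false f p≤0 x)) ,
    subst (λ e → 1 ℕ.≤ sparsity f ℕ.^ e) (sym P≡0) ℕ.≤-refl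
    where
    A≤0 : spectralNorm f ≤ 0ℚ
    A≤0 = subst (spectralNorm f ≤_) (∑-zero n) (∑-mono λ γ → ℚ.≤-trans (∣fourier∣≤mean f γ) p≤0)

    A≡0 : spectralNorm f ≡ 0ℚ
    A≡0 = ℚ.≤-antisym A≤0 (0≤spectralNorm f)

    P≡0 : P ≡ 0
    P≡0 = ℤ.+-injective (cong ℚ.↥_ (trans (sym A²≡Q) (cong₂ _*_ A≡0 A≡0)))

theorem1p3 : ∀ (n : ℕ) → 1 ℕ.≤ n → (f : Cube n → Bool) (A : ℚ) (s : ℕ) →
    spectralNorm f ≡ A → sparsity f ≡ s →
    ∃[ T ] (T Computes f × depth T ≤ A ℚ.* A ·log₂ s)
theorem1p3 n _ f A s refl refl = parity-tree-log f (A * A) refl
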